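{- Given an instance $I$ of the Post Correspondence Problem, one can compute a finite set $\mathbf{W}$ of generalized Wang tiles (with a distinguished color called white) such that $\mathbf{W}$ tiles a white rectangle if and only if $I$ admits a solution.
   Context: An instance of the Post Correspondence Problem (PCP) consists of a finite alphabet $\Sigma$, a positive integer $n$, and words $j_t,k_t\in\Sigma^*$ for $t\in\{1,\dots,n\}$; a solution is a positive integer $d$ and indices $e_1,\dots,e_d\in\{1,\dots,n\}$ such that the concatenations $j_{e_1}j_{e_2}\cdots j_{e_d}$ and $k_{e_1}k_{e_2}\cdots k_{e_d}$ are equal. A polyomino is a finite subset of $\mathbb{Z}^2$ whose shape (union of closed unit squares centered at its points) is simply connected; its boundary consists of unit-length horizontal and vertical edges. A generalized Wang tile is a polyomino each of whose boundary edges is labeled by a symbol called a color. A tiling of a region by generalized Wang tiles is a partition of the region into translated copies (no rotations) of the tiles such that any two edges of distinct tiles that coincide carry the same color. "$\mathbf{W}$ tiles a white rectangle" means that some rectangle admits a tiling by $\mathbf{W}$ in which every tile edge lying on the boundary of the rectangle has the color white. -}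

module Defs where

open import Data.Nat using (ℕ; suc; _≤_)
open import Data.Integer as ℤ using (ℤ; +_; -[1+_])
open import Data.Fin using (Fin)
open import Data.List using (List; []; _∷_; length; concatMap; lookup)
open import Data.List.Membership.Propositional using (_∈_)
open import Data.Product using (Σ; ∃; _×_; _,_; proj₁; proj₂)
open import Relation.Nullary using (¬_)
open import Relation.Binary.PropositionalEquality using (_≡_; _≢_)

-- An instance: alphabet Fin a (an arbitrary finite alphabet, up to
-- renaming), n ≥ 1 pairs of words (j t , k t).
record PCPInstance : Set where
  field
    a     : ℕ
    n     : ℕ
    n≥1   : 1 ≤ n
    j     : Fin n → List (Fin a)
    k     : Fin n → List (Fin a)

HasSolution : PCPInstance → Set
HasSolution I =
  Σ (List (Fin n)) λ e → (1 ≤ length e) × (concatMap j e ≡ concatMap k e)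
  where open PCPInstance I

ℤ² : Set
ℤ² = ℤ × ℤ

_⊕_ : ℤ² → ℤ² → ℤ²
(x , y) ⊕ (u , v) = (x ℤ.+ u , y ℤ.+ v)

_⊖_ : ℤ² → ℤ² → ℤ²
(x , y) ⊖ (u , v) = (x ℤ.- u , y ℤ.- v)

data Dir : Set where
  north east south west : Dir

unit : Dir → ℤ²
unit north = (+ 0 , + 1)
unit east  = (+ 1 , + 0)
unit south = (+ 0 , -[1+ 0 ])
unit west  = (-[1+ 0 ] , + 0)

opp : Dir → Dir
opp north = south
opp east  = west
opp south = north
opp west  = east

data Dir8 : Set where
  side   : Dir → Dir8
  ne nw se sw : Dir8

unit8 : Dir8 → ℤ²
unit8 (side d) = unit d
unit8 ne = (+ 1 , + 1)
unit8 nw = (-[1+ 0 ] , + 1)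
unit8 se = (+ 1 , -[1+ 0 ])
unit8 sw = (-[1+ 0 ] , -[1+ 0 ])

Adj4 : ℤ² → ℤ² → Set
Adj4 p q = ∃ λ d → q ≡ p ⊕ unit d

Adj8 : ℤ² → ℤ² → Set
Adj8 p q = ∃ λ d → q ≡ p ⊕ unit8 d

data Path (Adj : ℤ² → ℤ² → Set) (S : ℤ² → Set) : ℤ² → ℤ² → Set where
  here : ∀ {p} → S p → Path Adj S p p
  step : ∀ {p q r} → S p → Adj p q → Path Adj S q r → Path Adj S p r

Connected : (ℤ² → ℤ² → Set) → (ℤ² → Set) → Set
Connected Adj S = ∀ p q → S p → S q → Path Adj S p q

-- A finite set of cells P whose shape (union of the closed unit squares
-- centred at the cells) is simply connected.  For such a finite union of
-- closed squares: the shape is connected iff P is nonempty and connected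
-- under edge-or-corner adjacency; the shape has connected complement
-- (equivalently, for this compact planar cell complex, is simply
-- connected given it is connected) iff ℤ² ∖ P is connected under edge
-- adjacency.
IsPolyomino : List ℤ² → Set
IsPolyomino P =
  (∃ λ p → p ∈ P)
  × Connected Adj8 (λ p → p ∈ P)
  × Connected Adj4 (λ p → ¬ (p ∈ P))

Color : Set
Color = ℕ

-- The edge on side d of cell p is given color (color p d); only the
-- values on boundary edges (p ∈ cells, p ⊕ unit d ∉ cells) are ever used.
record WangTile : Set where
  field
    cells      : List ℤ²
    polyomino  : IsPolyomino cells
    color      : ℤ² → Dir → Color

record TileSet : Set where
  field
    tiles : List WangTile
    white : Color

InRect : ℕ → ℕ → ℤ² → Set
InRect w h (x , y) =
  (+ 0 ℤ.≤ x) × (x ℤ.< + w) × (+ 0 ℤ.≤ y) × (y ℤ.< + h)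

Placement : TileSet → Set
Placement W = Fin (length (TileSet.tiles W)) × ℤ²

module _ (W : TileSet) where
  open TileSet W

  tileOf : Placement W → WangTile
  tileOf (i , _) = lookup tiles i

  Covers : Placement W → ℤ² → Set
  Covers (i , v) x = (x ⊖ v) ∈ WangTile.cells (lookup tiles i)

  colorAt : Placement W → ℤ² → Dir → Color
  colorAt (i , v) x d = WangTile.color (lookup tiles i) (x ⊖ v) d

  -- A white tiling of the w × h rectangle by the list of placed copies ps
  -- (copies are identified by their position in ps).
  record WhiteTiling (w h : ℕ) (ps : List (Placement W)) : Set where
    field
      inside   : ∀ p x → Covers (lookup ps p) x → InRect w h x
      covered  : ∀ x → InRect w h x → ∃ λ p → Covers (lookup ps p) x
      disjoint : ∀ p q x → Covers (lookup ps p) x → Covers (lookup ps q) x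
                 → p ≡ q
      matching : ∀ p q x d → p ≢ q → Covers (lookup ps p) x
                 → Covers (lookup ps q) (x ⊕ unit d)
                 → colorAt (lookup ps p) x d
                   ≡ colorAt (lookup ps q) (x ⊕ unit d) (opp d)
      whiteBoundary : ∀ p x d → Covers (lookup ps p) x
                 → ¬ InRect w h (x ⊕ unit d)
                 → colorAt (lookup ps p) x d ≡ white

TilesWhiteRectangle : TileSet → Set
TilesWhiteRectangle W =
  Σ ℕ λ w → Σ ℕ λ h → (1 ≤ w) × (1 ≤ h)
  × Σ (List (Placement W)) λ ps → WhiteTiling W w h ps

{-# OPTIONS --safe #-}
-- A white tiling by one-cell tiles is the same as a stack of rows of square tiles, glued
-- west to east within a row and south to north between rows, with white outer sides.  The
-- tiles built from an instance make each row act on blocks: a block is a marker followed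
-- by cells carrying two tracks, which hold j_{e₁}⋯j_{e_i} and k_{e₁}⋯k_{e_i} padded with
-- blanks.  Above the white bottom edge only blocks with empty tracks can appear.  Above a
-- block, the next row either appends a pair t to both tracks (the signal passed eastwards
-- counts the letters of j_t and k_t already written into the first blanks) or erases the
-- block, which it can only do when the two tracks agree and some pair has been appended.
-- The top edge is white, so some block is erased, and its pair sequence is a solution.
-- Conversely a solution e with |j_{e₁}⋯j_{e_d}| = L is laid out on a rectangle of width
-- L + 1: an initialising row, one row per pair of e, and an erasing row.

module Submission where

open import Defs
open import Data.Bool using (Bool; true; false)
open import Data.Empty using (⊥-elim)
open import Data.Fin as Fin using (Fin; toℕ; fromℕ<; cast; combine; remQuot)
import Data.Fin.Properties as Fin
open import Data.Integer as ℤ using (ℤ; +_; +≤+; +<+)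
import Data.Integer.Properties as ℤ
open import Data.List
  using (List; []; _∷_; _++_; length; map; replicate; applyUpTo; lookup; tabulate; drop; concatMap; zipWith; upTo; allFin)
import Data.List.Properties as L
open import Data.List.Membership.Propositional using (_∈_; find; lose)
open import Data.List.Membership.Propositional.Properties
  using (∈-lookup; ∈-map⁺; ∈-map⁻; ∈-concatMap⁺; ∈-concatMap⁻; ∈-++⁺ˡ; ∈-++⁺ʳ; ∈-++⁻;
         ∈-upTo⁺; ∈-upTo⁻; ∈-allFin)
open import Data.List.Relation.Unary.Any as Any using (here; there)
open import Data.List.Relation.Unary.Any.Properties using (lookup-index)
open import Data.Maybe using (Maybe; just; nothing; maybe)
open import Data.Nat as ℕ using (ℕ; zero; suc; _≤_; _<_; z≤n; s≤s; _+_; _∸_; _<?_; _≟_)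
import Data.Nat.Properties as ℕ
open import Data.Nat.Binary as ℕᵇ using (ℕᵇ; 2[1+_]; 1+[2_])
import Data.Nat.Binary.Properties as ℕᵇ
open import Data.Product using (Σ; ∃; _×_; _,_; proj₁; proj₂; uncurry)
open import Data.Sum using (_⊎_; inj₁; inj₂)
open import Function using (_∘_)
open import Function.Bundles using (_⇔_; mk⇔; Equivalence)
open import Relation.Nullary using (¬_; Dec; yes; no; contradiction)
open import Relation.Nullary.Decidable using (_×-dec_)
open import Relation.Binary.PropositionalEquality hiding (J)

injective-from-retraction : ∀ {A B : Set} (f : A → B) (g : B → A) → (∀ x → g (f x) ≡ x) →
                            ∀ {x y} → f x ≡ f y → x ≡ y
injective-from-retraction f g gf≡id {x} {y} fx≡fy = trans (sym (gf≡id x)) (trans (cong g fx≡fy) (gf≡id y))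

module _ {A B : Set} where

  _⊗_ : List A → (A → List B) → List (A × B)
  xs ⊗ f = concatMap (λ x → map (x ,_) (f x)) xs

  ∈-⊗⁺ : ∀ {xs f a b} → a ∈ xs → b ∈ f a → (a , b) ∈ xs ⊗ f
  ∈-⊗⁺ {f = f} a∈xs b∈fa = ∈-concatMap⁺ (λ x → map (x ,_) (f x)) (lose a∈xs (∈-map⁺ (_ ,_) b∈fa))

  ∈-⊗⁻ : ∀ xs f {a b} → (a , b) ∈ xs ⊗ f → a ∈ xs × b ∈ f a
  ∈-⊗⁻ xs f ab∈ with a′ , a′∈xs , ab∈′ ← find (∈-concatMap⁻ (λ x → map (x ,_) (f x)) {xs = xs} ab∈)
                    with b′ , b′∈ , refl ← ∈-map⁻ (a′ ,_) ab∈′ = a′∈xs , b′∈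

module _ {A : Set} {P : Set} where

  when : Dec P → A → List A
  when (yes _) x = x ∷ []
  when (no _)  _ = []

  ∈-when⁺ : ∀ {x} (P? : Dec P) → P → x ∈ when P? x
  ∈-when⁺ (yes _) _ = here refl
  ∈-when⁺ (no ¬p) p = contradiction p ¬p

  ∈-when⁻ : ∀ {x y} (P? : Dec P) → y ∈ when P? x → P × y ≡ x
  ∈-when⁻ (yes p) (here y≡x) = p , y≡x

module _ {A B : Set} (f : A → List B) where

  ∈-concatMap-intro : ∀ {x xs y} → x ∈ xs → y ∈ f x → y ∈ concatMap f xs
  ∈-concatMap-intro x∈xs y∈fx = ∈-concatMap⁺ f (lose x∈xs y∈fx)

  ∈-concatMap-elim : ∀ xs {y} → y ∈ concatMap f xs → ∃ λ x → x ∈ xs × y ∈ f x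
  ∈-concatMap-elim xs y∈ = find (∈-concatMap⁻ f {xs = xs} y∈)

  concatMap-∷ʳ : ∀ xs x → concatMap f (xs ++ x ∷ []) ≡ concatMap f xs ++ f x
  concatMap-∷ʳ xs x = trans (L.concatMap-++ f xs (x ∷ [])) (cong (concatMap f xs ++_) (L.++-identityʳ (f x)))

  prefix-bound : ∀ p t rem → length (concatMap f p) + length (f t) ≤ length (concatMap f (p ++ t ∷ rem))
  prefix-bound p t rem = begin
    length (concatMap f p) + length (f t)
      ≤⟨ ℕ.+-monoʳ-≤ (length (concatMap f p)) (L.length-++-≤ˡ (f t)) ⟩
    length (concatMap f p) + length (f t ++ concatMap f rem)
      ≡⟨ L.length-++ (concatMap f p) ⟨
    length (concatMap f p ++ concatMap f (t ∷ rem))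
      ≡⟨ cong length (L.concatMap-++ f p (t ∷ rem)) ⟨
    length (concatMap f (p ++ t ∷ rem))
      ∎
    where open ℕ.≤-Reasoning

length-∷ʳ-positive : ∀ {A : Set} (xs : List A) x → 1 ≤ length (xs ++ x ∷ [])
length-∷ʳ-positive []      _ = s≤s z≤n
length-∷ʳ-positive (_ ∷ _) _ = s≤s z≤n

length≡0⇒≡[] : ∀ {A : Set} (xs : List A) → length xs ≡ 0 → xs ≡ []
length≡0⇒≡[] [] _ = refl

applyUpTo-cong : ∀ {A : Set} {f g : ℕ → A} k → (∀ {i} → i < k → f i ≡ g i) →
                 applyUpTo f k ≡ applyUpTo g k
applyUpTo-cong zero    f≡g = refl
applyUpTo-cong (suc k) f≡g = cong₂ _∷_ (f≡g (s≤s z≤n)) (applyUpTo-cong k (f≡g ∘ s≤s))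

applyUpTo-const : ∀ {A : Set} {f : ℕ → A} {c} k → (∀ {i} → i < k → f i ≡ c) →
                  applyUpTo f k ≡ replicate k c
applyUpTo-const zero    f≡c = refl
applyUpTo-const (suc k) f≡c = cong₂ _∷_ (f≡c (s≤s z≤n)) (applyUpTo-const k (f≡c ∘ s≤s))

toFin? : ∀ {m} → ℕ → Maybe (Fin m)
toFin? {m} i with i <? m
... | yes i<m = just (fromℕ< i<m)
... | no  _   = nothing

toFin?-toℕ : ∀ {m} (x : Fin m) → toFin? (toℕ x) ≡ just x
toFin?-toℕ {m} x with toℕ x <? m
... | yes x<m = cong just (Fin.fromℕ<-toℕ x x<m)
... | no  x≮m = ⊥-elim (x≮m (Fin.toℕ<n x))

module _ {A : Set} {n : ℕ} (f : Fin n → A) where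

  tabulateIndex : Fin (length (tabulate f)) → Fin n
  tabulateIndex = cast (L.length-tabulate f)

  lookup-tabulate-index : ∀ p → lookup (tabulate f) p ≡ f (tabulateIndex p)
  lookup-tabulate-index p = trans
    (cong (lookup (tabulate f)) (sym (Fin.cast-involutive (sym (L.length-tabulate f)) (L.length-tabulate f) p)))
    (L.lookup-tabulate f (tabulateIndex p))

  tabulateIndex-injective : ∀ {p q} → tabulateIndex p ≡ tabulateIndex q → p ≡ q
  tabulateIndex-injective {p} {q} p≡q = Fin.toℕ-injective
    (trans (sym (Fin.toℕ-cast _ p)) (trans (cong toℕ p≡q) (Fin.toℕ-cast _ q)))

  tabulateIndex-section : ∀ k → tabulateIndex (cast (sym (L.length-tabulate f)) k) ≡ k
  tabulateIndex-section = Fin.cast-involutive (L.length-tabulate f) (sym (L.length-tabulate f))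

-- Lists of naturals correspond to binary naturals: 2[1+_] conses a 0, 1+[2_] increments the head.
consᵇ : ℕ → ℕᵇ → ℕᵇ
consᵇ zero    r = 2[1+ r ]
consᵇ (suc x) r = 1+[2 consᵇ x r ]

listᵇ : List ℕ → ℕᵇ
listᵇ []       = ℕᵇ.zero
listᵇ (x ∷ xs) = consᵇ x (listᵇ xs)

unlistᵇ : ℕᵇ → List ℕ
unlistᵇ ℕᵇ.zero  = []
unlistᵇ 2[1+ r ] = 0 ∷ unlistᵇ r
unlistᵇ 1+[2 r ] with unlistᵇ r
... | []     = []
... | x ∷ xs = suc x ∷ xs

unlistᵇ-consᵇ : ∀ x r → unlistᵇ (consᵇ x r) ≡ x ∷ unlistᵇ r
unlistᵇ-consᵇ zero    r = refl
unlistᵇ-consᵇ (suc x) r rewrite unlistᵇ-consᵇ x r = refl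

unlistᵇ-listᵇ : ∀ xs → unlistᵇ (listᵇ xs) ≡ xs
unlistᵇ-listᵇ []       = refl
unlistᵇ-listᵇ (x ∷ xs) = trans (unlistᵇ-consᵇ x (listᵇ xs)) (cong (x ∷_) (unlistᵇ-listᵇ xs))

listCode : List ℕ → ℕ
listCode = ℕᵇ.toℕ ∘ listᵇ

decodeList : ℕ → List ℕ
decodeList n = unlistᵇ (ℕᵇ.fromℕ n)

decodeList-listCode : ∀ xs → decodeList (listCode xs) ≡ xs
decodeList-listCode xs = trans (cong unlistᵇ (ℕᵇ.fromℕ-toℕ (listᵇ xs))) (unlistᵇ-listᵇ xs)

origin : ℤ²
origin = (+ 0 , + 0)

module _ {Adj : ℤ² → ℤ² → Set} {S : ℤ² → Set} where

  Path-source : ∀ {p q} → Path Adj S p q → S p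
  Path-source (here s)     = s
  Path-source (step s _ _) = s

  Path-++ : ∀ {p q r} → Path Adj S p q → Path Adj S q r → Path Adj S p r
  Path-++ (here _)     Q = Q
  Path-++ (step s a P) Q = step s a (Path-++ P Q)

  Path-target-cast : ∀ {p q q′} → q ≡ q′ → Path Adj S p q → Path Adj S p q′
  Path-target-cast refl P = P

⊕-unit-opp : ∀ p d → (p ⊕ unit d) ⊕ unit (opp d) ≡ p
⊕-unit-opp (x , y) d = cong₂ _,_ (cancel x (opp-cancels d .proj₁)) (cancel y (opp-cancels d .proj₂))
  where
  cancel : ∀ x {i j} → i ℤ.+ j ≡ + 0 → (x ℤ.+ i) ℤ.+ j ≡ x
  cancel x {i} {j} i+j≡0 = trans (ℤ.+-assoc x i j) (trans (cong (λ k → x ℤ.+ k) i+j≡0) (ℤ.+-identityʳ x))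
  opp-cancels : ∀ d → (proj₁ (unit d) ℤ.+ proj₁ (unit (opp d)) ≡ + 0)
                    × (proj₂ (unit d) ℤ.+ proj₂ (unit (opp d)) ≡ + 0)
  opp-cancels north = refl , refl
  opp-cancels east  = refl , refl
  opp-cancels south = refl , refl
  opp-cancels west  = refl , refl

Adj4-sym : ∀ {p q} → Adj4 p q → Adj4 q p
Adj4-sym {p} (d , refl) = opp d , sym (⊕-unit-opp p d)

Path4-reverse : ∀ {S p q} → Path Adj4 S p q → Path Adj4 S q p
Path4-reverse (here s)     = here s
Path4-reverse (step s a P) = Path-++ (Path4-reverse P) (step (Path-source P) (Adj4-sym a) (here s))

NotOrigin : ℤ² → Set
NotOrigin p = ¬ (p ∈ origin ∷ [])

notOrigin-x : ∀ {x y} → x ≢ + 0 → NotOrigin (x , y)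
notOrigin-x x≢0 (here x,y≡0) = x≢0 (cong proj₁ x,y≡0)

notOrigin-y : ∀ {x y} → y ≢ + 0 → NotOrigin (x , y)
notOrigin-y y≢0 (here x,y≡0) = y≢0 (cong proj₂ x,y≡0)

i+∣j-i∣≡j : ∀ {a b} → a ℤ.≤ b → a ℤ.+ + ℤ.∣ b ℤ.- a ∣ ≡ b
i+∣j-i∣≡j {a} {b} a≤b = begin
  a ℤ.+ + ℤ.∣ b ℤ.- a ∣ ≡⟨ cong (λ k → a ℤ.+ k) (ℤ.0≤i⇒+∣i∣≡i (ℤ.i≤j⇒0≤j-i a≤b)) ⟩
  a ℤ.+ (b ℤ.- a)       ≡⟨ cong (λ k → a ℤ.+ k) (ℤ.+-comm b (ℤ.- a)) ⟩
  a ℤ.+ (ℤ.- a ℤ.+ b)   ≡⟨ sym (ℤ.+-assoc a (ℤ.- a) b) ⟩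
  (a ℤ.- a) ℤ.+ b       ≡⟨ cong (ℤ._+ b) (ℤ.+-inverseʳ a) ⟩
  + 0 ℤ.+ b             ≡⟨ ℤ.+-identityˡ b ⟩
  b                     ∎
  where open ≡-Reasoning

module _ (line : ℤ → ℤ²) (avoids : ∀ a → NotOrigin (line a))
         (forward : ∀ a → Adj4 (line a) (line (a ℤ.+ + 1))) where

  walk : ∀ a n → Path Adj4 NotOrigin (line a) (line (a ℤ.+ + n))
  walk a zero    = Path-target-cast (cong line (sym (ℤ.+-identityʳ a))) (here (avoids a))
  walk a (suc n) = step (avoids a) (forward a)
    (Path-target-cast (cong line (ℤ.+-assoc a (+ 1) (+ n))) (walk (a ℤ.+ + 1) n))

  segment : ∀ a b → Path Adj4 NotOrigin (line a) (line b)
  segment a b with ℤ.≤-total a b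
  ... | inj₁ a≤b = Path-target-cast (cong line (i+∣j-i∣≡j a≤b)) (walk a _)
  ... | inj₂ b≤a = Path4-reverse (Path-target-cast (cong line (i+∣j-i∣≡j b≤a)) (walk b _))

vertical : ∀ x → x ≢ + 0 → ∀ a b → Path Adj4 NotOrigin (x , a) (x , b)
vertical x x≢0 = segment (x ,_) (λ _ → notOrigin-x x≢0)
  (λ _ → north , cong₂ _,_ (sym (ℤ.+-identityʳ x)) refl)

horizontal : ∀ y → y ≢ + 0 → ∀ a b → Path Adj4 NotOrigin (a , y) (b , y)
horizontal y y≢0 = segment (_, y) (λ _ → notOrigin-y y≢0)
  (λ _ → east , cong₂ _,_ refl (sym (ℤ.+-identityʳ y)))

toCorner : ∀ p → NotOrigin p → Path Adj4 NotOrigin p (+ 1 , + 1)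
toCorner (x , y) p≢0 with x ℤ.≟ + 0
... | no x≢0   = Path-++ (vertical x x≢0 y (+ 1)) (horizontal (+ 1) (λ ()) x (+ 1))
... | yes refl = Path-++ (horizontal y (λ y≡0 → p≢0 (here (cong (+ 0 ,_) y≡0))) (+ 0) (+ 1))
                         (vertical (+ 1) (λ ()) y (+ 1))

singleCell-isPolyomino : IsPolyomino (origin ∷ [])
singleCell-isPolyomino = (origin , here refl) , cells-connected , complement-connected
  where
  cells-connected : Connected Adj8 (_∈ origin ∷ [])
  cells-connected _ _ (here refl) (here refl) = here (here refl)
  complement-connected : Connected Adj4 NotOrigin
  complement-connected p q p≢0 q≢0 = Path-++ (toCorner p p≢0) (Path4-reverse (toCorner q q≢0))

-- Rows, walls and grids of square tiles

record Square (H V : Set) : Set where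
  constructor ⟨_,_,_,_⟩
  field
    westColor  : H
    southColor : V
    northColor : V
    eastColor  : H
open Square public

module _ {H V : Set} where

  Fits : (H → V → V → H → Set) → Square H V → Set
  Fits T ⟨ w , s , n , e ⟩ = T w s n e

  data Row (T : H → V → V → H → Set) : H → List V → List V → H → Set where
    []  : ∀ {e} → Row T e [] [] e
    _∷_ : ∀ {w s n e bs ts e′} → T w s n e → Row T e bs ts e′ → Row T w (s ∷ bs) (n ∷ ts) e′

  data Wall (T : H → V → V → H → Set) (white : H) : List V → List V → Set where
    [_] : ∀ {bs ts} → Row T white bs ts white → Wall T white bs ts
    _∷_ : ∀ {bs ms ts} → Row T white bs ms white → Wall T white ms ts → Wall T white bs ts

  module _ {T T′ : H → V → V → H → Set} (f : ∀ {w s n e} → T w s n e → T′ w s n e) where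

    Row-map : ∀ {w bs ts e} → Row T w bs ts e → Row T′ w bs ts e
    Row-map []      = []
    Row-map (t ∷ r) = f t ∷ Row-map r

    Wall-map : ∀ {white bs ts} → Wall T white bs ts → Wall T′ white bs ts
    Wall-map [ r ]   = [ Row-map r ]
    Wall-map (r ∷ W) = Row-map r ∷ Wall-map W

  private variable
    T : H → V → V → H → Set
    w w′ e e′ white : H
    bs bs′ ts ts′ : List V

  Row-length : Row T w bs ts e → length ts ≡ length bs
  Row-length []      = refl
  Row-length (_ ∷ r) = cong suc (Row-length r)

  Row-castʷ : w ≡ w′ → Row T w bs ts e → Row T w′ bs ts e
  Row-castʷ refl r = r

  Row-castᵉ : e ≡ e′ → Row T w bs ts e → Row T w bs ts e′
  Row-castᵉ refl r = r

  Row-castᵗ : ts ≡ ts′ → Row T w bs ts e → Row T w bs ts′ e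
  Row-castᵗ refl r = r

  Row-castᵇ : bs ≡ bs′ → Row T w bs ts e → Row T w bs′ ts e
  Row-castᵇ refl r = r

  height : Wall T white bs ts → ℕ
  height [ _ ]   = 1
  height (_ ∷ W) = suc (height W)

module _ {H V : Set} (T : H → V → V → H → Set) (whiteʰ : H) (whiteᵛ : V) where

  -- square x y is the tile in column x and row y of a w × h rectangle.
  record Grid (w h : ℕ) : Set where
    field
      square      : ℕ → ℕ → Square H V
      fits        : ∀ {x y} → x < w → y < h → Fits T (square x y)
      east≡west   : ∀ {x y} → suc x < w → y < h →
                    eastColor (square x y) ≡ westColor (square (suc x) y)
      north≡south : ∀ {x y} → x < w → suc y < h →
                    northColor (square x y) ≡ southColor (square x (suc y))
      west-white  : ∀ {y} → y < h → westColor (square 0 y) ≡ whiteʰ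
      east-white  : ∀ {x y} → suc x ≡ w → y < h → eastColor (square x y) ≡ whiteʰ
      south-white : ∀ {x} → x < w → southColor (square x 0) ≡ whiteᵛ
      north-white : ∀ {x y} → x < w → suc y ≡ h → northColor (square x y) ≡ whiteᵛ

  WhiteWall : Set
  WhiteWall = Σ ℕ λ w → 1 ≤ w × Wall T whiteʰ (replicate w whiteᵛ) (replicate w whiteᵛ)

  rowOf : (c : ℕ → Square H V) (k : ℕ) → (∀ {i} → i ≤ k → Fits T (c i)) →
          (∀ {i} → i < k → eastColor (c i) ≡ westColor (c (suc i))) →
          Row T (westColor (c 0)) (applyUpTo (southColor ∘ c) (suc k))
                (applyUpTo (northColor ∘ c) (suc k)) (eastColor (c k))
  rowOf c zero    fits match = fits z≤n ∷ []
  rowOf c (suc k) fits match = fits z≤n ∷ Row-castʷ (sym (match (s≤s z≤n)))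
    (rowOf (c ∘ suc) k (fits ∘ s≤s) (match ∘ s≤s))

  grid⇒whiteWall : ∀ {w h} → 1 ≤ w → 1 ≤ h → Grid w h → WhiteWall
  grid⇒whiteWall {suc m} {suc n} (s≤s z≤n) (s≤s z≤n) G =
    suc m , s≤s z≤n , subst (λ bs → Wall T whiteʰ bs (replicate (suc m) whiteᵛ)) bottom-white (wallFrom 0 n refl)
    where
    open Grid G
    bottoms tops : ℕ → List V
    bottoms y = applyUpTo (λ x → southColor (square x y)) (suc m)
    tops    y = applyUpTo (λ x → northColor (square x y)) (suc m)

    gridRow : ∀ {y} → y < suc n → Row T whiteʰ (bottoms y) (tops y) whiteʰ
    gridRow y<h = Row-castʷ (west-white y<h) (Row-castᵉ (east-white refl y<h)
      (rowOf _ m (λ i≤m → fits (s≤s i≤m) y<h) (λ i<m → east≡west (s≤s i<m) y<h)))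

    bottom-white : bottoms 0 ≡ replicate (suc m) whiteᵛ
    bottom-white = applyUpTo-const (suc m) south-white

    wallFrom : ∀ y k → y ℕ.+ k ≡ n → Wall T whiteʰ (bottoms y) (replicate (suc m) whiteᵛ)
    wallFrom y zero    y≡n = [ Row-castᵗ top-white (gridRow y<h) ]
      where
      y<h = s≤s (subst (y ≤_) y≡n (ℕ.m≤m+n y 0))
      top-white = applyUpTo-const (suc m) (λ x<w → north-white x<w (cong suc (trans (sym (ℕ.+-identityʳ y)) y≡n)))
    wallFrom y (suc k) y+k≡n =
      Row-castᵗ (applyUpTo-cong (suc m) (λ x<w → north≡south x<w sy<h))
                (gridRow (ℕ.<-trans (ℕ.n<1+n y) sy<h))
      ∷ wallFrom (suc y) k (trans (sym (ℕ.+-suc y k)) y+k≡n)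
      where
      sy<h : suc y < suc n
      sy<h = s≤s (subst (suc y ≤_) y+k≡n (ℕ.m<m+n y (s≤s z≤n)))

  blankSquare : Square H V
  blankSquare = ⟨ whiteʰ , whiteᵛ , whiteᵛ , whiteʰ ⟩

  -- Lookup defaulting to white, so that the lemmas below need no bounds on x.
  _!_ : List V → ℕ → V
  []       ! _     = whiteᵛ
  (c ∷ _)  ! zero  = c
  (_ ∷ cs) ! suc x = cs ! x

  replicate-! : ∀ w x → replicate w whiteᵛ ! x ≡ whiteᵛ
  replicate-! zero    x       = refl
  replicate-! (suc w) zero    = refl
  replicate-! (suc w) (suc x) = replicate-! w x

  private variable
    w e : H
    bs ts : List V

  rowSquare : Row T w bs ts e → ℕ → Square H V
  rowSquare []                        _       = blankSquare
  rowSquare (_∷_ {w} {s} {n} {e} _ _) zero    = ⟨ w , s , n , e ⟩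
  rowSquare (_ ∷ r)                   (suc x) = rowSquare r x

  rowSquare-fits : (r : Row T w bs ts e) → ∀ {x} → x < length bs → Fits T (rowSquare r x)
  rowSquare-fits (t ∷ _) {zero}  _         = t
  rowSquare-fits (_ ∷ r) {suc x} (s≤s x<l) = rowSquare-fits r x<l

  rowSquare-east≡west : (r : Row T w bs ts e) → ∀ {x} → suc x < length bs →
                        eastColor (rowSquare r x) ≡ westColor (rowSquare r (suc x))
  rowSquare-east≡west (_ ∷ _ ∷ _) {zero}  _         = refl
  rowSquare-east≡west (_ ∷ r)     {suc x} (s≤s x<l) = rowSquare-east≡west r x<l

  rowSquare-west : (r : Row T whiteʰ bs ts e) → westColor (rowSquare r 0) ≡ whiteʰ
  rowSquare-west []      = refl
  rowSquare-west (_ ∷ _) = refl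

  rowSquare-east : (r : Row T w bs ts e) → ∀ {x} → suc x ≡ length bs → eastColor (rowSquare r x) ≡ e
  rowSquare-east (_ ∷ [])    {zero}  _    = refl
  rowSquare-east (_ ∷ r)     {suc x} x≡l  = rowSquare-east r (ℕ.suc-injective x≡l)

  rowSquare-south : (r : Row T w bs ts e) → ∀ x → southColor (rowSquare r x) ≡ bs ! x
  rowSquare-south []      _       = refl
  rowSquare-south (_ ∷ _) zero    = refl
  rowSquare-south (_ ∷ r) (suc x) = rowSquare-south r x

  rowSquare-north : (r : Row T w bs ts e) → ∀ x → northColor (rowSquare r x) ≡ ts ! x
  rowSquare-north []      _       = refl
  rowSquare-north (_ ∷ _) zero    = refl
  rowSquare-north (_ ∷ r) (suc x) = rowSquare-north r x

  wallSquare : Wall T whiteʰ bs ts → ℕ → ℕ → Square H V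
  wallSquare [ r ]   x _       = rowSquare r x
  wallSquare (r ∷ _) x zero    = rowSquare r x
  wallSquare (_ ∷ W) x (suc y) = wallSquare W x y

  module _ {x : ℕ} where

    wallSquare-fits : (W : Wall T whiteʰ bs ts) → ∀ {y} → x < length bs → y < height W →
                      Fits T (wallSquare W x y)
    wallSquare-fits [ r ]   {zero}  x<l _         = rowSquare-fits r x<l
    wallSquare-fits (r ∷ _) {zero}  x<l _         = rowSquare-fits r x<l
    wallSquare-fits [ _ ]   {suc _} _   (s≤s ())
    wallSquare-fits (r ∷ W) {suc y} x<l (s≤s y<h) =
      wallSquare-fits W (subst (x <_) (sym (Row-length r)) x<l) y<h

    wallSquare-east≡west : (W : Wall T whiteʰ bs ts) → ∀ {y} → suc x < length bs → y < height W →
                           eastColor (wallSquare W x y) ≡ westColor (wallSquare W (suc x) y)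
    wallSquare-east≡west [ r ]   {zero}  x<l _         = rowSquare-east≡west r x<l
    wallSquare-east≡west (r ∷ _) {zero}  x<l _         = rowSquare-east≡west r x<l
    wallSquare-east≡west [ _ ]   {suc _} _   (s≤s ())
    wallSquare-east≡west (r ∷ W) {suc y} x<l (s≤s y<h) =
      wallSquare-east≡west W (subst (suc x <_) (sym (Row-length r)) x<l) y<h

    wallSquare-east : (W : Wall T whiteʰ bs ts) → ∀ {y} → suc x ≡ length bs → y < height W →
                      eastColor (wallSquare W x y) ≡ whiteʰ
    wallSquare-east [ r ]   {zero}  x≡l _         = rowSquare-east r x≡l
    wallSquare-east (r ∷ _) {zero}  x≡l _         = rowSquare-east r x≡l
    wallSquare-east [ _ ]   {suc _} _   (s≤s ())
    wallSquare-east (r ∷ W) {suc y} x≡l (s≤s y<h) = wallSquare-east W (trans x≡l (sym (Row-length r))) y<h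

    wallSquare-south : (W : Wall T whiteʰ bs ts) → southColor (wallSquare W x 0) ≡ bs ! x
    wallSquare-south [ r ]   = rowSquare-south r x
    wallSquare-south (r ∷ _) = rowSquare-south r x

    wallSquare-north≡south : (W : Wall T whiteʰ bs ts) → ∀ {y} → suc y < height W →
                             northColor (wallSquare W x y) ≡ southColor (wallSquare W x (suc y))
    wallSquare-north≡south (r ∷ W) {zero}  _         =
      trans (rowSquare-north r x) (sym (wallSquare-south W))
    wallSquare-north≡south (_ ∷ W) {suc y} (s≤s y<h) = wallSquare-north≡south W y<h
    wallSquare-north≡south [ _ ]   (s≤s ())

    wallSquare-north : (W : Wall T whiteʰ bs ts) → ∀ {y} → suc y ≡ height W →
                       northColor (wallSquare W x y) ≡ ts ! x
    wallSquare-north [ r ]   {zero}  _     = rowSquare-north r x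
    wallSquare-north (_ ∷ W) {suc y} y≡h   = wallSquare-north W (ℕ.suc-injective y≡h)
    wallSquare-north (_ ∷ [ _ ]) {zero} ()
    wallSquare-north (_ ∷ _ ∷ _) {zero} ()

  wallSquare-west : (W : Wall T whiteʰ bs ts) → ∀ {y} → westColor (wallSquare W 0 y) ≡ whiteʰ
  wallSquare-west [ r ]           = rowSquare-west r
  wallSquare-west (r ∷ _) {zero}  = rowSquare-west r
  wallSquare-west (_ ∷ W) {suc y} = wallSquare-west W

  whiteWall⇒grid : ∀ {w} (W : Wall T whiteʰ (replicate w whiteᵛ) (replicate w whiteᵛ)) → Grid w (height W)
  whiteWall⇒grid {w} W = record
    { square      = wallSquare W
    ; fits        = λ x<w → wallSquare-fits W (width x<w)
    ; east≡west   = λ x<w → wallSquare-east≡west W (width x<w)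
    ; north≡south = λ _ → wallSquare-north≡south W
    ; west-white  = λ _ → wallSquare-west W
    ; east-white  = λ x≡w → wallSquare-east W (trans x≡w (sym (L.length-replicate w)))
    ; south-white = λ {x} _ → trans (wallSquare-south W) (replicate-! w x)
    ; north-white = λ {x} _ y≡h → trans (wallSquare-north W y≡h) (replicate-! w x)
    }
    where
    width : ∀ {x} → x < w → x < length (replicate w whiteᵛ)
    width {x} = subst (x <_) (sym (L.length-replicate w))

height-positive : ∀ {H V : Set} {T : H → V → V → H → Set} {white bs ts} (W : Wall T white bs ts) → 1 ≤ height W
height-positive [ _ ]   = s≤s z≤n
height-positive (_ ∷ _) = s≤s z≤n

Row-split : ∀ {H V : Set} {T : H → V → V → H → Set} {w e} bs {bs′ ts} → Row T w (bs ++ bs′) ts e →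
            Σ H λ m → Σ (List V) λ ts₁ → Σ (List V) λ ts₂ →
            ts ≡ ts₁ ++ ts₂ × Row T w bs ts₁ m × Row T m bs′ ts₂ e
Row-split []       r       = _ , [] , _ , refl , [] , r
Row-split (_ ∷ bs) (t ∷ r) with m , ts₁ , ts₂ , refl , r₁ , r₂ ← Row-split bs r =
  m , _ ∷ ts₁ , ts₂ , refl , t ∷ r₁ , r₂

WhiteWall-map : ∀ {H V : Set} {T T′ : H → V → V → H → Set} {whiteʰ whiteᵛ} →
                (∀ {w s n e} → T w s n e → T′ w s n e) →
                WhiteWall T whiteʰ whiteᵛ → WhiteWall T′ whiteʰ whiteᵛ
WhiteWall-map f (w , 1≤w , W) = w , 1≤w , Wall-map f W

-- Square tiles as Wang tiles

pos : ℕ → ℕ → ℤ²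
pos x y = (+ x , + y)

pos-injective : ∀ {x y x′ y′} → pos x y ≡ pos x′ y′ → x ≡ x′ × y ≡ y′
pos-injective refl = refl , refl

pos-north : ∀ x y → pos x y ⊕ unit north ≡ pos x (suc y)
pos-north x y = cong₂ _,_ (cong +_ (ℕ.+-identityʳ x)) (cong +_ (ℕ.+-comm y 1))

pos-east : ∀ x y → pos x y ⊕ unit east ≡ pos (suc x) y
pos-east x y = cong₂ _,_ (cong +_ (ℕ.+-comm x 1)) (cong +_ (ℕ.+-identityʳ y))

pos-south : ∀ x y → pos x (suc y) ⊕ unit south ≡ pos x y
pos-south x y = cong₂ _,_ (cong +_ (ℕ.+-identityʳ x)) refl

pos-west : ∀ x y → pos (suc x) y ⊕ unit west ≡ pos x y
pos-west x y = cong₂ _,_ refl (cong +_ (ℕ.+-identityʳ y))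

inRect : ∀ {w h x y} → x < w → y < h → InRect w h (pos x y)
inRect x<w y<h = +≤+ z≤n , +<+ x<w , +≤+ z≤n , +<+ y<h

Adjacent : Dir → ℕ × ℕ → ℕ × ℕ → Set
Adjacent north (x , y) (x′ , y′) = x′ ≡ x × y′ ≡ suc y
Adjacent east  (x , y) (x′ , y′) = x′ ≡ suc x × y′ ≡ y
Adjacent south p q = Adjacent north q p
Adjacent west  p q = Adjacent east q p

pos-adjacent : ∀ d {x y x′ y′} → pos x y ⊕ unit d ≡ pos x′ y′ → Adjacent d (x , y) (x′ , y′)
pos-adjacent north {x} {y} e = pos-injective (trans (sym e) (pos-north x y))
pos-adjacent east  {x} {y} e = pos-injective (trans (sym e) (pos-east x y))
pos-adjacent south {x} {zero}  ()
pos-adjacent south {x} {suc y} e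
  with x≡x′ , y≡y′ ← pos-injective (trans (sym (pos-south x y)) e) = x≡x′ , cong suc y≡y′
pos-adjacent west  {zero}  ()
pos-adjacent west  {suc x} {y} e
  with x≡x′ , y≡y′ ← pos-injective (trans (sym (pos-west x y)) e) = cong suc x≡x′ , y≡y′

adjacent-irrefl : ∀ d {p} → ¬ Adjacent d p p
adjacent-irrefl north (_ , y≡1+y) = ℕ.1+n≢n (sym y≡1+y)
adjacent-irrefl east  (x≡1+x , _) = ℕ.1+n≢n (sym x≡1+x)
adjacent-irrefl south (_ , y≡1+y) = ℕ.1+n≢n (sym y≡1+y)
adjacent-irrefl west  (x≡1+x , _) = ℕ.1+n≢n (sym x≡1+x)

record Palette (H V : Set) : Set where
  field
    encodeʰ           : H → Color
    encodeᵛ           : V → Color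
    encodeʰ-injective : ∀ {a b} → encodeʰ a ≡ encodeʰ b → a ≡ b
    encodeᵛ-injective : ∀ {a b} → encodeᵛ a ≡ encodeᵛ b → a ≡ b
    whiteʰ            : H
    whiteᵛ            : V
    white-agrees      : encodeᵛ whiteᵛ ≡ encodeʰ whiteʰ

module _ {H V : Set} (P : Palette H V) where
  open Palette P

  colorOf : Square H V → Dir → Color
  colorOf s north = encodeᵛ (northColor s)
  colorOf s east  = encodeʰ (eastColor s)
  colorOf s south = encodeᵛ (southColor s)
  colorOf s west  = encodeʰ (westColor s)

  squareTile : Square H V → WangTile
  squareTile s = record { cells = origin ∷ [] ; polyomino = singleCell-isPolyomino ; color = λ _ → colorOf s }

  squareTileSet : List (Square H V) → TileSet
  squareTileSet tiles = record { tiles = map squareTile tiles ; white = encodeʰ whiteʰ }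

  Listed : List (Square H V) → H → V → V → H → Set
  Listed tiles w s n e = ⟨ w , s , n , e ⟩ ∈ tiles

  module _ {tiles : List (Square H V)} where

    private
      tileSet = squareTileSet tiles

      listed : ∀ i → ∃ λ s → s ∈ tiles × lookup (map squareTile tiles) i ≡ squareTile s
      listed i = ∈-map⁻ squareTile (∈-lookup {xs = map squareTile tiles} i)

    placedSquare : Placement tileSet → Square H V
    placedSquare (i , _) = proj₁ (listed i)

    placedSquare∈ : ∀ pl → placedSquare pl ∈ tiles
    placedSquare∈ (i , _) = proj₁ (proj₂ (listed i))

    lookup-placed : ∀ pl → lookup (map squareTile tiles) (proj₁ pl) ≡ squareTile (placedSquare pl)
    lookup-placed (i , _) = proj₂ (proj₂ (listed i))

    colorAt-placed : ∀ pl z d → colorAt tileSet pl z d ≡ colorOf (placedSquare pl) d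
    colorAt-placed pl@(_ , v) z d = cong (λ t → WangTile.color t (z ⊖ v) d) (lookup-placed pl)

    covers⇒at : ∀ pl z → Covers tileSet pl z → z ≡ proj₂ pl
    covers⇒at pl@(_ , (a , b)) z@(x , y) covers
      with here z⊖v≡0 ← subst (λ t → (z ⊖ (a , b)) ∈ WangTile.cells t) (lookup-placed pl) covers =
      cong₂ _,_ (ℤ.i-j≡0⇒i≡j x a (cong proj₁ z⊖v≡0)) (ℤ.i-j≡0⇒i≡j y b (cong proj₂ z⊖v≡0))

    covers-at : ∀ pl → Covers tileSet pl (proj₂ pl)
    covers-at pl@(_ , (a , b)) = subst (λ t → ((a , b) ⊖ (a , b)) ∈ WangTile.cells t) (sym (lookup-placed pl))
      (here (cong₂ _,_ (ℤ.+-inverseʳ a) (ℤ.+-inverseʳ b)))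

    module _ {w h ps} (1≤w : 1 ≤ w) (1≤h : 1 ≤ h) (T : WhiteTiling tileSet w h ps) where
      open WhiteTiling T

      tilingSquare : ℕ → ℕ → Square H V
      tilingSquare x y with x <? w | y <? h
      ... | yes x<w | yes y<h = placedSquare (lookup ps (proj₁ (covered (pos x y) (inRect x<w y<h))))
      ... | _       | _       = ⟨ whiteʰ , whiteᵛ , whiteᵛ , whiteʰ ⟩

      square-covered : ∀ {x y} → x < w → y < h → ∃ λ p →
        Covers tileSet (lookup ps p) (pos x y) × tilingSquare x y ≡ placedSquare (lookup ps p)
      square-covered {x} {y} x<w y<h with x <? w | y <? h
      ... | yes x<w′ | yes y<h′ = let p , covers = covered (pos x y) (inRect x<w′ y<h′) in p , covers , refl
      ... | no x≮w   | _        = ⊥-elim (x≮w x<w)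
      ... | yes _    | no y≮h   = ⊥-elim (y≮h y<h)

      square-color : ∀ {x y} (x<w : x < w) (y<h : y < h) d →
        colorOf (tilingSquare x y) d ≡ colorAt tileSet (lookup ps (proj₁ (square-covered x<w y<h))) (pos x y) d
      square-color {x} {y} x<w y<h d = let p , _ , tilingSquare≡ = square-covered x<w y<h in
        trans (cong (λ s → colorOf s d) tilingSquare≡) (sym (colorAt-placed (lookup ps p) (pos x y) d))

      adjacent-colors : ∀ d {x y x′ y′} → x < w → y < h → x′ < w → y′ < h →
                        pos x y ⊕ unit d ≡ pos x′ y′ →
                        colorOf (tilingSquare x y) d ≡ colorOf (tilingSquare x′ y′) (opp d)
      adjacent-colors d {x} {y} {x′} {y′} x<w y<h x′<w y′<h next = begin
        colorOf (tilingSquare x y) d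
          ≡⟨ square-color x<w y<h d ⟩
        colorAt tileSet (lookup ps p) (pos x y) d
          ≡⟨ matching p q (pos x y) d p≢q covers-p covers-q′ ⟩
        colorAt tileSet (lookup ps q) (pos x y ⊕ unit d) (opp d)
          ≡⟨ cong (λ z → colorAt tileSet (lookup ps q) z (opp d)) next ⟩
        colorAt tileSet (lookup ps q) (pos x′ y′) (opp d)
          ≡⟨ square-color x′<w y′<h (opp d) ⟨
        colorOf (tilingSquare x′ y′) (opp d)
          ∎
        where
        open ≡-Reasoning
        p = proj₁ (square-covered x<w y<h)
        q = proj₁ (square-covered x′<w y′<h)
        covers-p = proj₁ (proj₂ (square-covered x<w y<h))
        covers-q = proj₁ (proj₂ (square-covered x′<w y′<h))
        covers-q′ = subst (Covers tileSet (lookup ps q)) (sym next) covers-q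
        p≢q : p ≢ q
        p≢q p≡q = adjacent-irrefl d (pos-adjacent d (trans next (trans (covers⇒at (lookup ps q) (pos x′ y′) covers-q)
          (trans (cong (λ r → proj₂ (lookup ps r)) (sym p≡q)) (sym (covers⇒at (lookup ps p) (pos x y) covers-p))))))

      boundary-color : ∀ d {x y} → x < w → y < h → ¬ InRect w h (pos x y ⊕ unit d) →
                       colorOf (tilingSquare x y) d ≡ encodeʰ whiteʰ
      boundary-color d {x} {y} x<w y<h outside = let p , covers , _ = square-covered x<w y<h in
        trans (square-color x<w y<h d) (whiteBoundary p (pos x y) d covers outside)

      tiling⇒grid : Grid (Listed tiles) whiteʰ whiteᵛ w h
      tiling⇒grid = record
        { square      = tilingSquare
        ; fits        = λ x<w y<h → let p , _ , tilingSquare≡ = square-covered x<w y<h in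
                          subst (_∈ tiles) (sym tilingSquare≡) (placedSquare∈ (lookup ps p))
        ; east≡west   = λ {x} {y} sx<w y<h → encodeʰ-injective
                          (adjacent-colors east (ℕ.<-trans (ℕ.n<1+n x) sx<w) y<h sx<w y<h (pos-east x y))
        ; north≡south = λ {x} {y} x<w sy<h → encodeᵛ-injective
                          (adjacent-colors north x<w (ℕ.<-trans (ℕ.n<1+n y) sy<h) x<w sy<h (pos-north x y))
        ; west-white  = λ y<h → encodeʰ-injective (boundary-color west 1≤w y<h λ { (() , _) })
        ; east-white  = λ { {x} {y} refl y<h → encodeʰ-injective (boundary-color east (ℕ.n<1+n x) y<h
                          λ inside → east-outside (subst (InRect w h) (pos-east x y) inside)) }
        ; south-white = λ x<w → encodeᵛ-injective (trans (boundary-color south x<w 1≤h λ { (_ , _ , () , _) })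
                          (sym white-agrees))
        ; north-white = λ { {x} {y} x<w refl → encodeᵛ-injective (trans (boundary-color north x<w (ℕ.n<1+n y)
                          λ inside → north-outside (subst (InRect w h) (pos-north x y) inside)) (sym white-agrees)) }
        }
        where
        east-outside : ∀ {x y h} → ¬ InRect (suc x) h (pos (suc x) y)
        east-outside (_ , +<+ x<x , _) = ℕ.n≮n _ x<x
        north-outside : ∀ {x y w} → ¬ InRect w (suc y) (pos x (suc y))
        north-outside (_ , _ , _ , +<+ y<y) = ℕ.n≮n _ y<y

    module _ {w h} (G : Grid (Listed tiles) whiteʰ whiteᵛ w h) where
      open Grid G

      grid-adjacent : ∀ d {x y x′ y′} → x < w → y < h → x′ < w → y′ < h →
                      Adjacent d (x , y) (x′ , y′) →
                      colorOf (square x y) d ≡ colorOf (square x′ y′) (opp d)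
      grid-adjacent north x<w _   _    y′<h (refl , refl) = cong encodeᵛ (north≡south x<w y′<h)
      grid-adjacent east  _   y<h x′<w _    (refl , refl) = cong encodeʰ (east≡west x′<w y<h)
      grid-adjacent south _   y<h x′<w _    (refl , refl) = sym (cong encodeᵛ (north≡south x′<w y<h))
      grid-adjacent west  x<w _   _    y′<h (refl , refl) = sym (cong encodeʰ (east≡west x<w y′<h))

      grid-boundary : ∀ d {x y} → x < w → y < h → ¬ InRect w h (pos x y ⊕ unit d) →
                      colorOf (square x y) d ≡ encodeʰ whiteʰ
      grid-boundary north {x} {y} x<w y<h outside with suc y <? h
      ... | yes sy<h = ⊥-elim (outside (subst (InRect w h) (sym (pos-north x y)) (inRect x<w sy<h)))
      ... | no  sy≮h = trans (cong encodeᵛ (north-white x<w (ℕ.≤-antisym y<h (ℕ.≮⇒≥ sy≮h)))) white-agrees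
      grid-boundary east  {x} {y} x<w y<h outside with suc x <? w
      ... | yes sx<w = ⊥-elim (outside (subst (InRect w h) (sym (pos-east x y)) (inRect sx<w y<h)))
      ... | no  sx≮w = cong encodeʰ (east-white (ℕ.≤-antisym x<w (ℕ.≮⇒≥ sx≮w)) y<h)
      grid-boundary south {x} {zero}  x<w _   _       = trans (cong encodeᵛ (south-white x<w)) white-agrees
      grid-boundary south {x} {suc y} x<w y<h outside =
        ⊥-elim (outside (subst (InRect w h) (sym (pos-south x y)) (inRect x<w (ℕ.<-trans (ℕ.n<1+n y) y<h))))
      grid-boundary west  {zero}  {y} _   y<h _       = cong encodeʰ (west-white y<h)
      grid-boundary west  {suc x} {y} x<w y<h outside =
        ⊥-elim (outside (subst (InRect w h) (sym (pos-west x y)) (inRect (ℕ.<-trans (ℕ.n<1+n x) x<w) y<h)))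

      placeAt : Fin h × Fin w → Placement tileSet
      placeAt (j , i) = Any.index (∈-map⁺ squareTile (fits (Fin.toℕ<n i) (Fin.toℕ<n j))) , pos (toℕ i) (toℕ j)

      colorAt-placeAt : ∀ c z d →
        colorAt tileSet (placeAt c) z d ≡ colorOf (square (toℕ (proj₂ c)) (toℕ (proj₁ c))) d
      colorAt-placeAt (j , i) z d = cong (λ t → WangTile.color t (z ⊖ pos (toℕ i) (toℕ j)) d)
        (sym (lookup-index (∈-map⁺ squareTile (fits (Fin.toℕ<n i) (Fin.toℕ<n j)))))

      placements : List (Placement tileSet)
      placements = tabulate (placeAt ∘ remQuot w)

      cellIndex : Fin (length placements) → Fin (h ℕ.* w)
      cellIndex = tabulateIndex (placeAt ∘ remQuot w)

      placedCell : Fin (length placements) → Fin h × Fin w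
      placedCell = remQuot w ∘ cellIndex

      X Y : Fin (length placements) → ℕ
      X p = toℕ (proj₂ (placedCell p))
      Y p = toℕ (proj₁ (placedCell p))

      lookup-placements : ∀ p → lookup placements p ≡ placeAt (placedCell p)
      lookup-placements = lookup-tabulate-index (placeAt ∘ remQuot w)

      placement-at : ∀ p z → Covers tileSet (lookup placements p) z → z ≡ pos (X p) (Y p)
      placement-at p z covers = trans (covers⇒at _ z covers) (cong proj₂ (lookup-placements p))

      placement-color : ∀ p z d → colorAt tileSet (lookup placements p) z d ≡ colorOf (square (X p) (Y p)) d
      placement-color p z d =
        trans (cong (λ pl → colorAt tileSet pl z d) (lookup-placements p)) (colorAt-placeAt (placedCell p) z d)

      placedCell-injective : ∀ {p q} → X p ≡ X q → Y p ≡ Y q → p ≡ q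
      placedCell-injective {p} {q} Xp≡Xq Yp≡Yq = tabulateIndex-injective (placeAt ∘ remQuot w) (begin
        cellIndex p              ≡⟨ Fin.combine-remQuot {h} w (cellIndex p) ⟨
        uncurry combine (placedCell p) ≡⟨ cong₂ combine (Fin.toℕ-injective Yp≡Yq) (Fin.toℕ-injective Xp≡Xq) ⟩
        uncurry combine (placedCell q) ≡⟨ Fin.combine-remQuot {h} w (cellIndex q) ⟩
        cellIndex q              ∎)
        where open ≡-Reasoning

      placedCell-at : ∀ {x y} (x<w : x < w) (y<h : y < h) →
                      Σ (Fin (length placements)) λ p → pos (X p) (Y p) ≡ pos x y
      placedCell-at {x} {y} x<w y<h = p , cong₂ pos (trans (cong (toℕ ∘ proj₂) placedCell-p) (Fin.toℕ-fromℕ< x<w))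
                                             (trans (cong (toℕ ∘ proj₁) placedCell-p) (Fin.toℕ-fromℕ< y<h))
        where
        k = combine (fromℕ< y<h) (fromℕ< x<w)
        p = cast (sym (L.length-tabulate (placeAt ∘ remQuot w))) k
        placedCell-p : placedCell p ≡ (fromℕ< y<h , fromℕ< x<w)
        placedCell-p = trans (cong (remQuot w) (tabulateIndex-section _ k)) (Fin.remQuot-combine _ _)

      gridTiling : WhiteTiling tileSet w h placements
      gridTiling = record
        { inside        = λ p z covers → subst (InRect w h) (sym (placement-at p z covers))
                            (inRect (Fin.toℕ<n (proj₂ (placedCell p))) (Fin.toℕ<n (proj₁ (placedCell p))))
        ; covered       = λ { (+ x , + y) (_ , +<+ x<w , _ , +<+ y<h) → let p , at = placedCell-at x<w y<h in
                            p , subst (Covers tileSet (lookup placements p)) (trans (cong proj₂ (lookup-placements p)) at)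
                                      (covers-at (lookup placements p)) }
        ; disjoint      = λ p q z covers-p covers-q → uncurry placedCell-injective
                            (pos-injective (trans (sym (placement-at p z covers-p)) (placement-at q z covers-q)))
        ; matching      = λ p q z d _ covers-p covers-q → begin
            colorAt tileSet (lookup placements p) z d ≡⟨ placement-color p z d ⟩
            colorOf (square (X p) (Y p)) d          ≡⟨ grid-adjacent d (x< p) (y< p) (x< q) (y< q) (pos-adjacent d
                                                          (trans (cong (_⊕ unit d) (sym (placement-at p z covers-p)))
                                                                 (placement-at q (z ⊕ unit d) covers-q))) ⟩
            colorOf (square (X q) (Y q)) (opp d)    ≡⟨ placement-color q (z ⊕ unit d) (opp d) ⟨
            colorAt tileSet (lookup placements q) (z ⊕ unit d) (opp d) ∎
        ; whiteBoundary = λ p z d covers outside → trans (placement-color p z d)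
            (grid-boundary d (x< p) (y< p) (subst (λ z → ¬ InRect w h (z ⊕ unit d)) (placement-at p z covers) outside))
        }
        where
        open ≡-Reasoning
        x< : ∀ p → X p < w
        x< p = Fin.toℕ<n (proj₂ (placedCell p))
        y< : ∀ p → Y p < h
        y< p = Fin.toℕ<n (proj₁ (placedCell p))

    whiteRectangle⇔whiteWall : TilesWhiteRectangle tileSet ⇔ WhiteWall (Listed tiles) whiteʰ whiteᵛ
    whiteRectangle⇔whiteWall = mk⇔
      (λ (w , h , 1≤w , 1≤h , _ , T) → grid⇒whiteWall _ _ _ 1≤w 1≤h (tiling⇒grid 1≤w 1≤h T))
      (λ (w , 1≤w , W) → w , height W , 1≤w , height-positive W , _ , gridTiling (whiteWall⇒grid _ _ _ W))

-- Writing a word onto a track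

module _ {A : Set} where

  -- nothing is a blank.
  pad : List A → ℕ → List (Maybe A)
  pad P r = map just P ++ replicate r nothing

  length-pad : ∀ P r → length (pad P r) ≡ length P + r
  length-pad P r = trans (L.length-++ (map just P)) (cong₂ _+_ (L.length-map just P) (L.length-replicate r))

  pad-injective : ∀ P Q {r r′} → pad P r ≡ pad Q r′ → P ≡ Q
  pad-injective []      []      _  = refl
  pad-injective []      (_ ∷ _) {suc _} ()
  pad-injective (_ ∷ _) []      {r′ = suc _} ()
  pad-injective (x ∷ P) (y ∷ Q) eq with refl , eq′ ← L.∷-injective eq = cong (x ∷_) (pad-injective P Q eq′)

  pad≡[] : ∀ P r → pad P r ≡ [] → P ≡ [] × r ≡ 0
  pad≡[] [] zero _ = refl , refl

  -- Appending u to a track, left to right: the state s counts the letters of u already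
  -- written; letters of the old word are kept only while nothing has been written, and
  -- the letters of u go into the first blanks.
  fill : List A → ℕ → Maybe A × ℕ
  fill []      s = nothing , s
  fill (y ∷ _) s = just y , suc s

  write : List A → ℕ → Maybe A → Maybe (Maybe A × ℕ)
  write u s       nothing  = just (fill (drop s u) s)
  write u zero    (just x) = just (just x , zero)
  write u (suc s) (just x) = nothing

  data Writes (u : List A) : ℕ → List (Maybe A) → List (Maybe A) → ℕ → Set where
    done : ∀ {s s′} → s ≡ s′ → Writes u s [] [] s′
    _∷_  : ∀ {s x y s′ xs ys s″} → write u s x ≡ just (y , s′) → Writes u s′ xs ys s″ →
           Writes u s (x ∷ xs) (y ∷ ys) s″

  drop-suc : ∀ s (u : List A) {y ys} → drop s u ≡ y ∷ ys → drop (suc s) u ≡ ys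
  drop-suc zero    (_ ∷ _) refl = refl
  drop-suc (suc s) (_ ∷ u) eq   = drop-suc s u eq

  drop-nonempty : ∀ s (u : List A) {y ys} → drop s u ≡ y ∷ ys → s < length u
  drop-nonempty zero    (_ ∷ _) refl = s≤s z≤n
  drop-nonempty (suc s) (_ ∷ u) eq   = s≤s (drop-nonempty s u eq)

  drop-empty : ∀ s (u : List A) → s ≤ length u → drop s u ≡ [] → s ≡ length u
  drop-empty zero    []      _         _  = refl
  drop-empty (suc s) (_ ∷ u) (s≤s s≤l) eq = cong suc (drop-empty s u s≤l eq)

  write-bound : ∀ u s x {y s′} → write u s x ≡ just (y , s′) → s ≤ length u → s′ ≤ length u
  write-bound u zero (just x) refl s≤l = s≤l
  write-bound u s nothing eq s≤l with drop s u in drop≡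
  write-bound u s nothing refl s≤l | []    = s≤l
  write-bound u s nothing refl s≤l | _ ∷ _ = drop-nonempty s u drop≡

  blanks⁻ : ∀ u s r {ys} → Writes u s (replicate r nothing) ys (length u) →
            length (drop s u) ≤ r × ys ≡ pad (drop s u) (r ∸ length (drop s u))
  blanks⁻ u s zero (done s≡l) rewrite L.drop-all s u (ℕ.≤-reflexive (sym s≡l)) = z≤n , refl
  blanks⁻ u s (suc r) (w ∷ W) with drop s u in drop≡
  blanks⁻ u s (suc r) (refl ∷ W) | [] =
    z≤n , cong (nothing ∷_) (trans (proj₂ (blanks⁻ u s r W)) (cong (λ v → pad v (r ∸ length v)) drop≡))
  blanks⁻ u s (suc r) (refl ∷ W) | z ∷ zs rewrite sym (drop-suc s u drop≡) =
    let bound , ys≡ = blanks⁻ u (suc s) r W in s≤s bound , cong (just z ∷_) ys≡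

  blanks⁺ : ∀ u s r → s ≤ length u → length (drop s u) ≤ r →
            Writes u s (replicate r nothing) (pad (drop s u) (r ∸ length (drop s u))) (length u)
  blanks⁺ u s zero s≤l bound with drop s u in drop≡
  ... | [] = done (drop-empty s u s≤l drop≡)
  blanks⁺ u s (suc r) s≤l bound with drop s u in drop≡
  ... | [] = cong (λ v → just (fill v s)) drop≡
           ∷ subst (λ v → Writes u s (replicate r nothing) (pad v (r ∸ length v)) (length u)) drop≡
                   (blanks⁺ u s r s≤l (subst (λ v → length v ≤ r) (sym drop≡) z≤n))
  ... | z ∷ zs = cong (λ v → just (fill v s)) drop≡
           ∷ subst (λ v → Writes u (suc s) (replicate r nothing) (pad v (r ∸ length v)) (length u)) (drop-suc s u drop≡)
                   (blanks⁺ u (suc s) r (drop-nonempty s u drop≡)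
                            (subst (λ v → length v ≤ r) (sym (drop-suc s u drop≡)) (ℕ.≤-pred bound)))

  letters⁻ : ∀ u P r {ys} → Writes u 0 (pad P r) ys (length u) →
             length u ≤ r × ys ≡ pad (P ++ u) (r ∸ length u)
  letters⁻ u []      r W          = blanks⁻ u 0 r W
  letters⁻ u (x ∷ P) r (refl ∷ W) = let bound , ys≡ = letters⁻ u P r W in bound , cong (just x ∷_) ys≡

  letters⁺ : ∀ u P r → length u ≤ r → Writes u 0 (pad P r) (pad (P ++ u) (r ∸ length u)) (length u)
  letters⁺ u []      r bound = blanks⁺ u 0 r z≤n bound
  letters⁺ u (x ∷ P) r bound = refl ∷ letters⁺ u P r bound

-- The tiles simulating an instance

module PCPTiling (I : PCPInstance) where
  open PCPInstance I

  Symbol : Set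
  Symbol = Maybe (Fin a)

  -- Colours of horizontal edges: a block of a row starts with a marker (true once a pair
  -- has been appended) followed by cells holding one symbol of each of the two tracks.
  data Content : Set where
    empty  : Content
    marker : Bool → Content
    cell   : Symbol → Symbol → Content

  -- Colours of vertical edges: the signal passed from west to east along a row; while
  -- appending pair t it records how many letters of j t and of k t have been written.
  data Signal : Set where
    idle initialise erase : Signal
    append : Fin n → ℕ → ℕ → Signal

  blankCell : Content
  blankCell = cell nothing nothing

  -- A "-first" or "-more" tile passes its signal on eastwards; a "-single" or "-last" tile
  -- ends the block with idle.
  data Tile : Signal → Content → Content → Signal → Set where
    initialise-first  : Tile idle empty (marker false) initialise
    initialise-single : Tile idle empty (marker false) idle
    initialise-more   : Tile initialise empty blankCell initialise
    initialise-last   : Tile initialise empty blankCell idle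
    append-first      : ∀ f t → Tile idle (marker f) (marker true) (append t 0 0)
    append-single     : ∀ f t → length (j t) ≡ 0 → length (k t) ≡ 0 → Tile idle (marker f) (marker true) idle
    append-more       : ∀ {t s₁ s₂ x₁ x₂ y₁ y₂ s₁′ s₂′} → s₁ ≤ length (j t) → s₂ ≤ length (k t) →
                        write (j t) s₁ x₁ ≡ just (y₁ , s₁′) → write (k t) s₂ x₂ ≡ just (y₂ , s₂′) →
                        Tile (append t s₁ s₂) (cell x₁ x₂) (cell y₁ y₂) (append t s₁′ s₂′)
    append-last       : ∀ {t s₁ s₂ x₁ x₂ y₁ y₂ s₁′ s₂′} → s₁ ≤ length (j t) → s₂ ≤ length (k t) →
                        write (j t) s₁ x₁ ≡ just (y₁ , s₁′) → write (k t) s₂ x₂ ≡ just (y₂ , s₂′) →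
                        s₁′ ≡ length (j t) → s₂′ ≡ length (k t) →
                        Tile (append t s₁ s₂) (cell x₁ x₂) (cell y₁ y₂) idle
    erase-first       : Tile idle (marker true) empty erase
    erase-single      : Tile idle (marker true) empty idle
    erase-more        : ∀ x → Tile erase (cell x x) empty erase
    erase-last        : ∀ x → Tile erase (cell x x) empty idle

  symbols : List Symbol
  symbols = nothing ∷ map just (allFin a)

  ∈-symbols : ∀ x → x ∈ symbols
  ∈-symbols nothing  = here refl
  ∈-symbols (just x) = there (∈-map⁺ just (∈-allFin x))

  fixedTiles : List (Square Signal Content)
  fixedTiles = ⟨ idle , empty , marker false , initialise ⟩ ∷ ⟨ idle , empty , marker false , idle ⟩
             ∷ ⟨ initialise , empty , blankCell , initialise ⟩ ∷ ⟨ initialise , empty , blankCell , idle ⟩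
             ∷ ⟨ idle , marker true , empty , erase ⟩ ∷ ⟨ idle , marker true , empty , idle ⟩ ∷ []

  appendFirstTiles : Bool × Fin n → List (Square Signal Content)
  appendFirstTiles (f , t) = ⟨ idle , marker f , marker true , append t 0 0 ⟩
    ∷ when (length (j t) ≟ 0 ×-dec length (k t) ≟ 0) ⟨ idle , marker f , marker true , idle ⟩

  eraseTiles : Symbol → List (Square Signal Content)
  eraseTiles x = ⟨ erase , cell x x , empty , erase ⟩ ∷ ⟨ erase , cell x x , empty , idle ⟩ ∷ []

  AppendParameters : Set
  AppendParameters = Fin n × ℕ × ℕ × Symbol × Symbol

  appendTilesAfter : AppendParameters → Maybe (Symbol × ℕ) → Maybe (Symbol × ℕ) → List (Square Signal Content)
  appendTilesAfter (t , s₁ , s₂ , x₁ , x₂) (just (y₁ , s₁′)) (just (y₂ , s₂′)) =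
    ⟨ append t s₁ s₂ , cell x₁ x₂ , cell y₁ y₂ , append t s₁′ s₂′ ⟩
    ∷ when (s₁′ ≟ length (j t) ×-dec s₂′ ≟ length (k t))
           ⟨ append t s₁ s₂ , cell x₁ x₂ , cell y₁ y₂ , idle ⟩
  appendTilesAfter _ _ _ = []

  appendTiles : AppendParameters → List (Square Signal Content)
  appendTiles p@(t , s₁ , s₂ , x₁ , x₂) = appendTilesAfter p (write (j t) s₁ x₁) (write (k t) s₂ x₂)

  symbolPairs : List (Symbol × Symbol)
  symbolPairs = symbols ⊗ λ _ → symbols

  statesAndSymbols : Fin n → List (ℕ × ℕ × Symbol × Symbol)
  statesAndSymbols t = upTo (suc (length (j t))) ⊗ λ _ → upTo (suc (length (k t))) ⊗ λ _ → symbolPairs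

  appendParameters : List AppendParameters
  appendParameters = allFin n ⊗ statesAndSymbols

  appendParameters-bounds : ∀ {t s₁ s₂ x₁ x₂} → (t , s₁ , s₂ , x₁ , x₂) ∈ appendParameters →
                            s₁ ≤ length (j t) × s₂ ≤ length (k t)
  appendParameters-bounds {t} p∈
    with _   , p∈₁ ← ∈-⊗⁻ (allFin n) statesAndSymbols p∈
    with s₁∈ , p∈₂ ← ∈-⊗⁻ (upTo _) (λ _ → upTo (suc (length (k t))) ⊗ λ _ → symbolPairs) p∈₁
    with s₂∈ , _   ← ∈-⊗⁻ (upTo _) (λ _ → symbolPairs) p∈₂ =
    ℕ.≤-pred (∈-upTo⁻ s₁∈) , ℕ.≤-pred (∈-upTo⁻ s₂∈)

  ∈-appendParameters : ∀ {t s₁ s₂} x₁ x₂ → s₁ ≤ length (j t) → s₂ ≤ length (k t) →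
                       (t , s₁ , s₂ , x₁ , x₂) ∈ appendParameters
  ∈-appendParameters {t} x₁ x₂ s₁≤ s₂≤ = ∈-⊗⁺ (∈-allFin t) (∈-⊗⁺ (∈-upTo⁺ (s≤s s₁≤))
    (∈-⊗⁺ (∈-upTo⁺ (s≤s s₂≤)) (∈-⊗⁺ {f = λ _ → symbols} (∈-symbols x₁) (∈-symbols x₂))))

  appendFirstParameters : List (Bool × Fin n)
  appendFirstParameters = (false ∷ true ∷ []) ⊗ λ _ → allFin n

  tiles : List (Square Signal Content)
  tiles = fixedTiles ++ concatMap appendFirstTiles appendFirstParameters
       ++ concatMap eraseTiles symbols ++ concatMap appendTiles appendParameters

  appendTilesAfter-sound : ∀ {t s₁ s₂ x₁ x₂ m₁ m₂ sq} → s₁ ≤ length (j t) → s₂ ≤ length (k t) →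
    write (j t) s₁ x₁ ≡ m₁ → write (k t) s₂ x₂ ≡ m₂ →
    sq ∈ appendTilesAfter (t , s₁ , s₂ , x₁ , x₂) m₁ m₂ → Fits Tile sq
  appendTilesAfter-sound {m₁ = just _} {just _} s₁≤ s₂≤ w₁ w₂ (here refl) = append-more s₁≤ s₂≤ w₁ w₂
  appendTilesAfter-sound {t} {m₁ = just (_ , s₁′)} {just (_ , s₂′)} s₁≤ s₂≤ w₁ w₂ (there sq∈)
    with (e₁ , e₂) , refl ← ∈-when⁻ (s₁′ ≟ length (j t) ×-dec s₂′ ≟ length (k t)) sq∈ =
    append-last s₁≤ s₂≤ w₁ w₂ e₁ e₂

  fixedTiles-sound : ∀ {sq} → sq ∈ fixedTiles → Fits Tile sq
  fixedTiles-sound (here refl)                                       = initialise-first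
  fixedTiles-sound (there (here refl))                               = initialise-single
  fixedTiles-sound (there (there (here refl)))                       = initialise-more
  fixedTiles-sound (there (there (there (here refl))))               = initialise-last
  fixedTiles-sound (there (there (there (there (here refl)))))       = erase-first
  fixedTiles-sound (there (there (there (there (there (here refl)))))) = erase-single

  appendFirstTiles-sound : ∀ f t {sq} → sq ∈ appendFirstTiles (f , t) → Fits Tile sq
  appendFirstTiles-sound f t (here refl) = append-first f t
  appendFirstTiles-sound f t (there sq∈)
    with (e₁ , e₂) , refl ← ∈-when⁻ (length (j t) ≟ 0 ×-dec length (k t) ≟ 0) sq∈ = append-single f t e₁ e₂

  eraseTiles-sound : ∀ x {sq} → sq ∈ eraseTiles x → Fits Tile sq
  eraseTiles-sound x (here refl)         = erase-more x
  eraseTiles-sound x (there (here refl)) = erase-last x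

  appendTiles-sound : ∀ {t s₁ s₂ x₁ x₂ sq} → (t , s₁ , s₂ , x₁ , x₂) ∈ appendParameters →
                      sq ∈ appendTiles (t , s₁ , s₂ , x₁ , x₂) → Fits Tile sq
  appendTiles-sound p∈ = let s₁≤ , s₂≤ = appendParameters-bounds p∈ in
    appendTilesAfter-sound s₁≤ s₂≤ refl refl

  tiles-sound : ∀ {sq} → sq ∈ tiles → Fits Tile sq
  tiles-sound sq∈ with ∈-++⁻ fixedTiles sq∈
  ... | inj₁ sq∈₁ = fixedTiles-sound sq∈₁
  ... | inj₂ sq∈₁ with ∈-++⁻ (concatMap appendFirstTiles appendFirstParameters) sq∈₁
  ... | inj₁ sq∈₂ = let (f , t) , _ , sq∈₃ = ∈-concatMap-elim appendFirstTiles appendFirstParameters sq∈₂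
                    in appendFirstTiles-sound f t sq∈₃
  ... | inj₂ sq∈₂ with ∈-++⁻ (concatMap eraseTiles symbols) sq∈₂
  ... | inj₁ sq∈₃ = let x , _ , sq∈₄ = ∈-concatMap-elim eraseTiles symbols sq∈₃ in eraseTiles-sound x sq∈₄
  ... | inj₂ sq∈₃ = let _ , p∈ , sq∈₄ = ∈-concatMap-elim appendTiles appendParameters sq∈₃
                    in appendTiles-sound p∈ sq∈₄

  appendTilesAfter-complete : ∀ {t s₁ s₂ x₁ x₂ m₁ m₂ sq} →
    write (j t) s₁ x₁ ≡ m₁ → write (k t) s₂ x₂ ≡ m₂ →
    sq ∈ appendTilesAfter (t , s₁ , s₂ , x₁ , x₂) m₁ m₂ → sq ∈ appendTiles (t , s₁ , s₂ , x₁ , x₂)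
  appendTilesAfter-complete refl refl sq∈ = sq∈

  appendFirstTiles⊆tiles : ∀ f t {sq} → sq ∈ appendFirstTiles (f , t) → sq ∈ tiles
  appendFirstTiles⊆tiles f t sq∈ = ∈-++⁺ʳ fixedTiles (∈-++⁺ˡ (∈-concatMap-intro appendFirstTiles
    (∈-⊗⁺ {f = λ _ → allFin n} (∈-bools f) (∈-allFin t)) sq∈))
    where
    ∈-bools : ∀ f → f ∈ false ∷ true ∷ []
    ∈-bools false = here refl
    ∈-bools true  = there (here refl)

  eraseTiles⊆tiles : ∀ x {sq} → sq ∈ eraseTiles x → sq ∈ tiles
  eraseTiles⊆tiles x sq∈ = ∈-++⁺ʳ fixedTiles (∈-++⁺ʳ (concatMap appendFirstTiles appendFirstParameters)
    (∈-++⁺ˡ (∈-concatMap-intro eraseTiles (∈-symbols x) sq∈)))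

  appendTiles⊆tiles : ∀ {t s₁ s₂ x₁ x₂ sq} → s₁ ≤ length (j t) → s₂ ≤ length (k t) →
              sq ∈ appendTiles (t , s₁ , s₂ , x₁ , x₂) → sq ∈ tiles
  appendTiles⊆tiles {x₁ = x₁} {x₂} s₁≤ s₂≤ sq∈ =
    ∈-++⁺ʳ fixedTiles (∈-++⁺ʳ (concatMap appendFirstTiles appendFirstParameters) (∈-++⁺ʳ (concatMap eraseTiles symbols)
      (∈-concatMap-intro appendTiles (∈-appendParameters x₁ x₂ s₁≤ s₂≤) sq∈)))

  tiles-complete : ∀ {w s n e} → Tile w s n e → ⟨ w , s , n , e ⟩ ∈ tiles
  tiles-complete initialise-first  = here refl
  tiles-complete initialise-single = there (here refl)
  tiles-complete initialise-more   = there (there (here refl))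
  tiles-complete initialise-last   = there (there (there (here refl)))
  tiles-complete erase-first       = there (there (there (there (here refl))))
  tiles-complete erase-single      = there (there (there (there (there (here refl)))))
  tiles-complete (append-first f t)          = appendFirstTiles⊆tiles f t (here refl)
  tiles-complete (append-single f t e₁ e₂)   = appendFirstTiles⊆tiles f t (there (∈-when⁺ _ (e₁ , e₂)))
  tiles-complete (erase-more x)              = eraseTiles⊆tiles x (here refl)
  tiles-complete (erase-last x)              = eraseTiles⊆tiles x (there (here refl))
  tiles-complete (append-more s₁≤ s₂≤ w₁ w₂) =
    appendTiles⊆tiles s₁≤ s₂≤ (appendTilesAfter-complete w₁ w₂ (here refl))
  tiles-complete (append-last s₁≤ s₂≤ w₁ w₂ e₁ e₂) =
    appendTiles⊆tiles s₁≤ s₂≤ (appendTilesAfter-complete w₁ w₂ (there (∈-when⁺ _ (e₁ , e₂))))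

  symbolCode : Symbol → ℕ
  symbolCode nothing  = 0
  symbolCode (just x) = suc (toℕ x)

  decodeSymbol : ℕ → Symbol
  decodeSymbol zero    = nothing
  decodeSymbol (suc i) = toFin? i

  decodeSymbol-code : ∀ x → decodeSymbol (symbolCode x) ≡ x
  decodeSymbol-code nothing  = refl
  decodeSymbol-code (just x) = toFin?-toℕ x

  contentCode : Content → List ℕ
  contentCode empty          = []
  contentCode (marker false) = 1 ∷ []
  contentCode (marker true)  = 2 ∷ []
  contentCode (cell x y)     = 3 ∷ symbolCode x ∷ symbolCode y ∷ []

  decodeContent : List ℕ → Content
  decodeContent (1 ∷ [])         = marker false
  decodeContent (2 ∷ [])         = marker true
  decodeContent (3 ∷ x ∷ y ∷ []) = cell (decodeSymbol x) (decodeSymbol y)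
  decodeContent _                = empty

  decodeContent-code : ∀ c → decodeContent (contentCode c) ≡ c
  decodeContent-code empty          = refl
  decodeContent-code (marker false) = refl
  decodeContent-code (marker true)  = refl
  decodeContent-code (cell x y)     = cong₂ cell (decodeSymbol-code x) (decodeSymbol-code y)

  signalCode : Signal → List ℕ
  signalCode idle             = []
  signalCode initialise       = 1 ∷ []
  signalCode erase            = 2 ∷ []
  signalCode (append t s₁ s₂) = 3 ∷ toℕ t ∷ s₁ ∷ s₂ ∷ []

  decodeSignal : List ℕ → Signal
  decodeSignal (1 ∷ [])               = initialise
  decodeSignal (2 ∷ [])               = erase
  decodeSignal (3 ∷ t ∷ s₁ ∷ s₂ ∷ []) = maybe (λ t → append t s₁ s₂) idle (toFin? t)
  decodeSignal _                      = idle

  decodeSignal-code : ∀ s → decodeSignal (signalCode s) ≡ s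
  decodeSignal-code idle             = refl
  decodeSignal-code initialise       = refl
  decodeSignal-code erase            = refl
  decodeSignal-code (append t s₁ s₂) = cong (maybe (λ t → append t s₁ s₂) idle) (toFin?-toℕ t)

  palette : Palette Signal Content
  palette = record
    { encodeʰ           = listCode ∘ signalCode
    ; encodeᵛ           = listCode ∘ contentCode
    ; encodeʰ-injective = injective-from-retraction _ (decodeSignal ∘ decodeList)
                            (λ s → trans (cong decodeSignal (decodeList-listCode (signalCode s))) (decodeSignal-code s))
    ; encodeᵛ-injective = injective-from-retraction _ (decodeContent ∘ decodeList)
                            (λ c → trans (cong decodeContent (decodeList-listCode (contentCode c))) (decodeContent-code c))
    ; whiteʰ            = idle
    ; whiteᵛ            = empty
    ; white-agrees      = refl
    }

  J K : List (Fin n) → List (Fin a)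
  J e = concatMap j e
  K e = concatMap k e

  tracks : List Symbol → List Symbol → List Content
  tracks = zipWith cell

  -- A block of a row records a sequence e of pairs: its tracks hold J e and K e, each
  -- padded with blanks to the width of the block; the marker is true once e is nonempty.
  data Block : List Content → Set where
    block : ∀ f e r₁ r₂ → (f ≡ true → 1 ≤ length e) → length (J e) + r₁ ≡ length (K e) + r₂ →
            Block (marker f ∷ tracks (pad (J e) r₁) (pad (K e) r₂))

  data Blocks : List Content → Set where
    []  : Blocks []
    _∷_ : ∀ {b bs} → Block b → Blocks bs → Blocks (b ++ bs)

  no-idle-cell : ∀ {x y n e} → ¬ Tile idle (cell x y) n e
  no-idle-cell ()

  idleRow-empty : ∀ u₁ u₂ {ts} → length u₁ ≡ length u₂ → Row Tile idle (tracks u₁ u₂) ts idle →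
                  u₁ ≡ [] × u₂ ≡ [] × ts ≡ []
  idleRow-empty []       []       _ []      = refl , refl , refl
  idleRow-empty (_ ∷ _)  (_ ∷ _)  _ (t ∷ _) = ⊥-elim (no-idle-cell t)

  markerRow-west : ∀ {w f bs ts e} → Row Tile w (marker f ∷ bs) ts e → w ≡ idle
  markerRow-west (append-first _ _ ∷ _)      = refl
  markerRow-west (append-single _ _ _ _ ∷ _) = refl
  markerRow-west (erase-first ∷ _)           = refl
  markerRow-west (erase-single ∷ _)          = refl

  blocksRow-west : ∀ {w bs ts} → Blocks bs → Row Tile w bs ts idle → w ≡ idle
  blocksRow-west []                        []      = refl
  blocksRow-west (block _ _ _ _ _ _ ∷ _) r = markerRow-west r

  appendRow⁻ : ∀ t s₁ s₂ u₁ u₂ {ts} → length u₁ ≡ length u₂ →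
               Row Tile (append t s₁ s₂) (tracks u₁ u₂) ts idle →
              Σ (List Symbol) λ u₁′ → Σ (List Symbol) λ u₂′ → ts ≡ tracks u₁′ u₂′
              × Writes (j t) s₁ u₁ u₁′ (length (j t)) × Writes (k t) s₂ u₂ u₂′ (length (k t))
  appendRow⁻ t s₁ s₂ (x₁ ∷ u₁) (x₂ ∷ u₂) |u|≡ (append-more {y₁ = y₁} {y₂} _ _ w₁ w₂ ∷ r)
    with u₁′ , u₂′ , refl , W₁ , W₂ ← appendRow⁻ t _ _ u₁ u₂ (ℕ.suc-injective |u|≡) r =
    y₁ ∷ u₁′ , y₂ ∷ u₂′ , refl , w₁ ∷ W₁ , w₂ ∷ W₂
  appendRow⁻ t s₁ s₂ (x₁ ∷ u₁) (x₂ ∷ u₂) |u|≡ (append-last {y₁ = y₁} {y₂} _ _ w₁ w₂ e₁ e₂ ∷ r)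
    with refl , refl , refl ← idleRow-empty u₁ u₂ (ℕ.suc-injective |u|≡) r =
    y₁ ∷ [] , y₂ ∷ [] , refl , w₁ ∷ done e₁ , w₂ ∷ done e₂

  eraseRow⁻ : ∀ u₁ u₂ {ts} → length u₁ ≡ length u₂ → Row Tile erase (tracks u₁ u₂) ts idle → u₁ ≡ u₂
  eraseRow⁻ (x ∷ u₁) (.x ∷ u₂) |u|≡ (erase-more .x ∷ r) =
    cong (x ∷_) (eraseRow⁻ u₁ u₂ (ℕ.suc-injective |u|≡) r)
  eraseRow⁻ (x ∷ u₁) (.x ∷ u₂) |u|≡ (erase-last .x ∷ r)
    with refl , refl , refl ← idleRow-empty u₁ u₂ (ℕ.suc-injective |u|≡) r = refl

  J-∷ʳ : ∀ e t → J (e ++ t ∷ []) ≡ J e ++ j t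
  J-∷ʳ = concatMap-∷ʳ j

  K-∷ʳ : ∀ e t → K (e ++ t ∷ []) ≡ K e ++ k t
  K-∷ʳ = concatMap-∷ʳ k

  appendedBlock : ∀ e t r₁ r₂ → length (J e) + r₁ ≡ length (K e) + r₂ →
                  length (j t) ≤ r₁ → length (k t) ≤ r₂ →
    Block (marker true ∷ tracks (pad (J e ++ j t) (r₁ ∸ length (j t))) (pad (K e ++ k t) (r₂ ∸ length (k t))))
  appendedBlock e t r₁ r₂ |e|≡ |jt|≤ |kt|≤ =
    subst₂ (λ P Q → Block (marker true ∷ tracks (pad P (r₁ ∸ length (j t))) (pad Q (r₂ ∸ length (k t)))))
      (J-∷ʳ e t) (K-∷ʳ e t)
      (block true (e ++ t ∷ []) _ _ (λ _ → length-∷ʳ-positive e t) (begin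
        length (J (e ++ t ∷ [])) + (r₁ ∸ length (j t)) ≡⟨ cong (λ P → length P + _) (J-∷ʳ e t) ⟩
        length (J e ++ j t) + (r₁ ∸ length (j t))      ≡⟨ length-append (J e) (j t) r₁ |jt|≤ ⟩
        length (J e) + r₁                              ≡⟨ |e|≡ ⟩
        length (K e) + r₂                              ≡⟨ length-append (K e) (k t) r₂ |kt|≤ ⟨
        length (K e ++ k t) + (r₂ ∸ length (k t))      ≡⟨ cong (λ Q → length Q + _) (K-∷ʳ e t) ⟨
        length (K (e ++ t ∷ [])) + (r₂ ∸ length (k t)) ∎))
    where
    open ≡-Reasoning
    length-append : ∀ (P u : List (Fin a)) r → length u ≤ r → length (P ++ u) + (r ∸ length u) ≡ length P + r
    length-append P u r |u|≤r = begin
      length (P ++ u) + (r ∸ length u)         ≡⟨ cong (_+ (r ∸ length u)) (L.length-++ P) ⟩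
      length P + length u + (r ∸ length u)     ≡⟨ ℕ.+-assoc (length P) (length u) _ ⟩
      length P + (length u + (r ∸ length u))   ≡⟨ cong (λ m → length P + m) (ℕ.m+[n∸m]≡n |u|≤r) ⟩
      length P + r                             ∎

  equal-widths : ∀ {e r₁ r₂} → length (J e) + r₁ ≡ length (K e) + r₂ →
                 length (pad (J e) r₁) ≡ length (pad (K e) r₂)
  equal-widths {e} {r₁} {r₂} |e|≡ = trans (length-pad (J e) r₁) (trans |e|≡ (sym (length-pad (K e) r₂)))

  blockRow : ∀ {b ts} → Block b → Row Tile idle b ts idle → HasSolution I ⊎ Block ts
  blockRow (block f e r₁ r₂ nonempty |e|≡) (append-first _ t ∷ r)
    with u₁′ , u₂′ , refl , W₁ , W₂ ← appendRow⁻ t 0 0 (pad (J e) r₁) (pad (K e) r₂) (equal-widths {e} |e|≡) r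
    with |jt|≤ , refl ← letters⁻ (j t) (J e) r₁ W₁
    with |kt|≤ , refl ← letters⁻ (k t) (K e) r₂ W₂ = inj₂ (appendedBlock e t r₁ r₂ |e|≡ |jt|≤ |kt|≤)
  blockRow (block f e r₁ r₂ nonempty |e|≡) (append-single _ t |jt|≡0 |kt|≡0 ∷ r)
    with pad₁≡[] , pad₂≡[] , refl ← idleRow-empty (pad (J e) r₁) (pad (K e) r₂) (equal-widths {e} |e|≡) r
    with Je≡[] , refl ← pad≡[] (J e) r₁ pad₁≡[]
    with Ke≡[] , refl ← pad≡[] (K e) r₂ pad₂≡[] =
    inj₂ (subst Block (cong (marker true ∷_)
                            (cong₂ tracks (nothing-left Je≡[] |jt|≡0) (nothing-left Ke≡[] |kt|≡0)))
                (appendedBlock e t 0 0 |e|≡ (ℕ.≤-reflexive |jt|≡0) (ℕ.≤-reflexive |kt|≡0)))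
    where
    nothing-left : ∀ {P u : List (Fin a)} → P ≡ [] → length u ≡ 0 → pad (P ++ u) (0 ∸ length u) ≡ []
    nothing-left {u = u} refl |u|≡0 rewrite length≡0⇒≡[] u |u|≡0 = refl
  blockRow (block true e r₁ r₂ nonempty |e|≡) (erase-first ∷ r) =
    inj₁ (e , nonempty refl ,
          pad-injective (J e) (K e) (eraseRow⁻ (pad (J e) r₁) (pad (K e) r₂) (equal-widths {e} |e|≡) r))
  blockRow (block true e r₁ r₂ nonempty |e|≡) (erase-single ∷ r)
    with pad₁≡[] , pad₂≡[] , refl ← idleRow-empty (pad (J e) r₁) (pad (K e) r₂) (equal-widths {e} |e|≡) r =
    inj₁ (e , nonempty refl ,
          trans (proj₁ (pad≡[] (J e) r₁ pad₁≡[])) (sym (proj₁ (pad≡[] (K e) r₂ pad₂≡[]))))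

  blocksRow : ∀ {bs ts} → Blocks bs → Row Tile idle bs ts idle → HasSolution I ⊎ Blocks ts
  blocksRow []               []  = inj₂ []
  blocksRow (_∷_ {b} B⁰ Bs) r
    with _ , _ , _ , refl , r₁ , r₂ ← Row-split b r
    with refl ← blocksRow-west Bs r₂
    with blockRow B⁰ r₁ | blocksRow Bs r₂
  ... | inj₁ solution | _              = inj₁ solution
  ... | inj₂ _        | inj₁ solution  = inj₁ solution
  ... | inj₂ B¹       | inj₂ Bs′       = inj₂ (B¹ ∷ Bs′)

  initialBlock : ∀ r → Block (marker false ∷ replicate r blankCell)
  initialBlock r = subst (λ cs → Block (marker false ∷ cs)) (L.zipWith-replicate r cell nothing nothing)
                         (block false [] r r (λ ()) refl)

  initialRow⁻ : ∀ m {ts} → Row Tile idle (replicate m empty) ts idle → Blocks ts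
  initialisingRow⁻ : ∀ m {ts} → Row Tile initialise (replicate m empty) ts idle →
                    Σ ℕ λ r → Σ (List Content) λ ts′ → ts ≡ replicate r blankCell ++ ts′ × Blocks ts′

  initialRow⁻ zero    []                        = []
  initialRow⁻ (suc m) (initialise-first ∷ r)
    with r′ , _ , refl , Bs ← initialisingRow⁻ m r =
    _∷_ {marker false ∷ replicate r′ blankCell} (initialBlock r′) Bs
  initialRow⁻ (suc m) (initialise-single ∷ r) = _∷_ {marker false ∷ []} (initialBlock 0) (initialRow⁻ m r)

  initialisingRow⁻ (suc m) (initialise-more ∷ r)
    with r′ , ts′ , refl , Bs ← initialisingRow⁻ m r = suc r′ , ts′ , refl , Bs
  initialisingRow⁻ (suc m) (initialise-last ∷ r) = 1 , _ , refl , initialRow⁻ m r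

  blocks-not-white : ∀ m → ¬ Blocks (replicate (suc m) empty)
  blocks-not-white m Bs = not-white Bs refl
    where
    not-white : ∀ {bs} → Blocks bs → ¬ bs ≡ replicate (suc m) empty
    not-white []                        ()
    not-white (block _ _ _ _ _ _ ∷ _) ()

  wallSolution : ∀ {m bs} → Blocks bs → Wall Tile idle bs (replicate (suc m) empty) → HasSolution I
  wallSolution {m} Bs [ r ] with blocksRow Bs r
  ... | inj₁ solution = solution
  ... | inj₂ Bs′      = ⊥-elim (blocks-not-white m Bs′)
  wallSolution Bs (r ∷ W) with blocksRow Bs r
  ... | inj₁ solution = solution
  ... | inj₂ Bs′      = wallSolution Bs′ W

  whiteWall⇒solution : WhiteWall Tile idle empty → HasSolution I
  whiteWall⇒solution (suc m , _ , [ r ]) = ⊥-elim (blocks-not-white m (initialRow⁻ (suc m) r))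
  whiteWall⇒solution (suc m , _ , r ∷ W) = wallSolution (initialRow⁻ (suc m) r) W

  appendRow⁺ : ∀ t s₁ s₂ u₁ u₂ u₁′ u₂′ → s₁ ≤ length (j t) → s₂ ≤ length (k t) →
               length u₁ ≡ length u₂ → 1 ≤ length u₁ →
               Writes (j t) s₁ u₁ u₁′ (length (j t)) → Writes (k t) s₂ u₂ u₂′ (length (k t)) →
               Row Tile (append t s₁ s₂) (tracks u₁ u₂) (tracks u₁′ u₂′) idle
  appendRow⁺ t s₁ s₂ (x₁ ∷ []) (x₂ ∷ []) _ _ s₁≤ s₂≤ _ _ (w₁ ∷ done e₁) (w₂ ∷ done e₂) =
    append-last s₁≤ s₂≤ w₁ w₂ e₁ e₂ ∷ []
  appendRow⁺ t s₁ s₂ (x₁ ∷ u₁@(_ ∷ _)) (x₂ ∷ u₂@(_ ∷ _)) _ _ s₁≤ s₂≤ |u|≡ _ (w₁ ∷ W₁) (w₂ ∷ W₂) =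
    append-more s₁≤ s₂≤ w₁ w₂ ∷ appendRow⁺ t _ _ u₁ u₂ _ _
      (write-bound (j t) s₁ x₁ w₁ s₁≤) (write-bound (k t) s₂ x₂ w₂ s₂≤) (ℕ.suc-injective |u|≡) (s≤s z≤n) W₁ W₂
  appendRow⁺ t s₁ s₂ (_ ∷ []) (_ ∷ _ ∷ _) _ _ _ _ () _ _ _
  appendRow⁺ t s₁ s₂ (_ ∷ _ ∷ _) (_ ∷ []) _ _ _ _ () _ _ _

  markerRow⁺ : ∀ f t P₁ P₂ P₁′ P₂′ → length P₁ ≡ length P₂ →
               Writes (j t) 0 P₁ P₁′ (length (j t)) → Writes (k t) 0 P₂ P₂′ (length (k t)) →
               Row Tile idle (marker f ∷ tracks P₁ P₂) (marker true ∷ tracks P₁′ P₂′) idle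
  markerRow⁺ f t []         []         [] [] _   (done e₁) (done e₂) = append-single f t (sym e₁) (sym e₂) ∷ []
  markerRow⁺ f t P₁@(_ ∷ _) P₂@(_ ∷ _) _  _  |P|≡ W₁        W₂        =
    append-first f t ∷ appendRow⁺ t 0 0 P₁ P₂ _ _ z≤n z≤n |P|≡ (s≤s z≤n) W₁ W₂
  markerRow⁺ f t [] (_ ∷ _) _ _ () _ _
  markerRow⁺ f t (_ ∷ _) [] _ _ () _ _

  eraseRow⁺ : ∀ P → Row Tile idle (marker true ∷ tracks P P) (empty ∷ replicate (length P) empty) idle
  eraseRow⁺ []      = erase-single ∷ []
  eraseRow⁺ (x ∷ P) = erase-first ∷ erasing x P
    where
    erasing : ∀ x P → Row Tile erase (tracks (x ∷ P) (x ∷ P)) (replicate (length (x ∷ P)) empty) idle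
    erasing x []      = erase-last x ∷ []
    erasing x (y ∷ P) = erase-more x ∷ erasing y P

  initialRow⁺ : ∀ m → Row Tile idle (replicate (suc m) empty) (marker false ∷ replicate m blankCell) idle
  initialRow⁺ zero    = initialise-single ∷ []
  initialRow⁺ (suc m) = initialise-first ∷ initialising m
    where
    initialising : ∀ m → Row Tile initialise (replicate (suc m) empty) (replicate (suc m) blankCell) idle
    initialising zero    = initialise-last ∷ []
    initialising (suc m) = initialise-more ∷ initialising m

  module Forward (e : List (Fin n)) (J≡K : J e ≡ K e) where

    width : ℕ
    width = length (J e)

    padTo : List (Fin a) → List Symbol
    padTo P = pad P (width ∸ length P)

    blockAfter : Bool → List (Fin n) → List Content
    blockAfter f p = marker f ∷ tracks (padTo (J p)) (padTo (K p))

    length-padTo : ∀ P → length P ≤ width → length (padTo P) ≡ width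
    length-padTo P |P|≤ = trans (length-pad P _) (ℕ.m+[n∸m]≡n |P|≤)

    padTo-++ : ∀ P u → pad (P ++ u) ((width ∸ length P) ∸ length u) ≡ padTo (P ++ u)
    padTo-++ P u = cong (pad (P ++ u)) (trans (ℕ.∸-+-assoc width (length P) (length u))
                                              (cong (width ∸_) (sym (L.length-++ P))))

    appendRow : ∀ f p t rem → p ++ t ∷ rem ≡ e →
                Row Tile idle (blockAfter f p) (blockAfter true (p ++ t ∷ [])) idle
    appendRow f p t rem p++t++rem≡e =
      Row-castᵗ (cong₂ (λ P Q → marker true ∷ tracks P Q)
                       (trans (padTo-++ (J p) (j t)) (cong padTo (sym (J-∷ʳ p t))))
                       (trans (padTo-++ (K p) (k t)) (cong padTo (sym (K-∷ʳ p t)))))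
        (markerRow⁺ f t (padTo (J p)) (padTo (K p)) _ _
          (trans (length-padTo (J p) (fits-prefix (J p) (j t) J-bound))
                 (sym (length-padTo (K p) (fits-prefix (K p) (k t) K-bound))))
          (letters⁺ (j t) (J p) _ (fits-room (J p) (j t) J-bound))
          (letters⁺ (k t) (K p) _ (fits-room (K p) (k t) K-bound)))
      where
      J-bound : length (J p) + length (j t) ≤ width
      J-bound = subst (λ q → length (J p) + length (j t) ≤ length (J q)) p++t++rem≡e (prefix-bound j p t rem)
      K-bound : length (K p) + length (k t) ≤ width
      K-bound = subst (λ q → length (K p) + length (k t) ≤ q)
                      (trans (cong (length ∘ K) p++t++rem≡e) (cong length (sym J≡K))) (prefix-bound k p t rem)
      fits-prefix : ∀ (P u : List (Fin a)) → length P + length u ≤ width → length P ≤ width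
      fits-prefix P u = ℕ.≤-trans (ℕ.m≤m+n (length P) (length u))
      fits-room : ∀ (P u : List (Fin a)) → length P + length u ≤ width → length u ≤ width ∸ length P
      fits-room P u bound = ℕ.m+n≤o⇒m≤o∸n (length u) (subst (_≤ width) (ℕ.+-comm (length P) (length u)) bound)

    eraseRow : Row Tile idle (blockAfter true e) (replicate (suc width) empty) idle
    eraseRow = Row-castᵇ (cong (λ Q → marker true ∷ tracks (padTo (J e)) (padTo Q)) J≡K)
                 (Row-castᵗ (cong (λ w → empty ∷ replicate w empty) (length-padTo (J e) ℕ.≤-refl))
                   (eraseRow⁺ (padTo (J e))))

    wallFrom : ∀ p rem → p ++ rem ≡ e → Wall Tile idle (blockAfter true p) (replicate (suc width) empty)
    wallFrom p []        p++[]≡e = [ subst (λ q → Row Tile idle (blockAfter true q) _ idle)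
                                           (trans (sym p++[]≡e) (L.++-identityʳ p)) eraseRow ]
    wallFrom p (t ∷ rem) p++rem≡e =
      appendRow true p t rem p++rem≡e ∷ wallFrom (p ++ t ∷ []) rem (trans (L.++-assoc p (t ∷ []) rem) p++rem≡e)

    initialRow : Row Tile idle (replicate (suc width) empty) (blockAfter false []) idle
    initialRow = Row-castᵗ (cong (marker false ∷_) (sym (L.zipWith-replicate width cell nothing nothing)))
                           (initialRow⁺ width)

  solution⇒whiteWall : HasSolution I → WhiteWall Tile idle empty
  solution⇒whiteWall (t ∷ rest , _ , J≡K) =
    suc width , s≤s z≤n , initialRow ∷ appendRow false [] t rest refl ∷ wallFrom (t ∷ []) rest refl
    where open Forward (t ∷ rest) J≡K

pcpTileSet : PCPInstance → TileSet
pcpTileSet I = squareTileSet palette tiles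
  where open PCPTiling I

mainTheorem4 : Σ (PCPInstance → TileSet)
                 (λ f → (I : PCPInstance) → TilesWhiteRectangle (f I) ⇔ HasSolution I)
mainTheorem4 = pcpTileSet , λ I → let open PCPTiling I in mk⇔
  (whiteWall⇒solution ∘ WhiteWall-map tiles-sound ∘ Equivalence.to (whiteRectangle⇔whiteWall palette))
  (Equivalence.from (whiteRectangle⇔whiteWall palette) ∘ WhiteWall-map tiles-complete ∘ solution⇒whiteWall)
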